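{- Let $S$ and $T$ be disjoint non-empty finite sets. Let $H_0=(S,T;F_0)$ be a simple bipartite graph and let $G_0$ be its bipartite complement. Let $M_S=(S,r_S)$ be a matroid on $S$, let $p_T$ be an integer-valued fully supermodular set-function on $T$, and let $m_V=(m_S,m_T)$ be a degree-specification (non-negative integers) on $S\cup T$ with $\widetilde m_S(S)=\widetilde m_T(T)=\gamma$. Then there exists a bipartite graph $G=(S,T;E)$ fitting $m_V$ for which $G^+=G+H_0$ is simple and $M_S$-covers $p_T$ if and only if both $$\widetilde m_S(X)+\widetilde m_T(Y)-d_{G_0}(X,Y)\le\gamma\quad\text{for all } X\subseteq S,\ Y\subseteq T,$$ and $$\widetilde m_S(X)+\widetilde m_T(Y)-d_{G_0}(X,Y)+p_T(T_0)-r_S(X\cup\Gamma_{H_0}(T_0))\le\gamma\quad\text{for all } X\subseteq S,\ Y\subseteq T,\ T_0\subseteq T-Y.$$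
   Context: A bipartite graph (bigraph) $G=(S,T;E)$ has all edges between $S$ and $T$; parallel edges are a priori allowed, and $G$ is simple if it has none. The bipartite complement of a simple bigraph $H_0=(S,T;F_0)$ is $G_0=(S,T;E_0)$ where $E_0$ consists of all pairs $st$ ($s\in S,t\in T$) not in $F_0$; $G+H_0$ denotes the bigraph with edge set $E\cup F_0$. $d_{G_0}(X,Y)$ is the number of edges of $G_0$ joining $X\subseteq S$ and $Y\subseteq T$. $\Gamma_H(Y)$ is the set of neighbours in $S$ of $Y\subseteq T$ in the bigraph $H$. $\widetilde m(Z)=\sum_{v\in Z}m(v)$. $G$ fits $m_V$ if $d_G(v)=m_V(v)$ for all $v\in S\cup T$. A set-function $p$ on $T$ is fully supermodular if $p(A)+p(B)\le p(A\cap B)+p(A\cup B)$ for all $A,B\subseteq T$. $G$ $M_S$-covers $p_T$ if $r_S(\Gamma_G(Y))\ge p_T(Y)$ for every $Y\subseteq T$, where $r_S$ is the rank function of $M_S$. -}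

module Defs where

open import Data.Nat using (ℕ; zero; suc; _+_; _≤_; _≡ᵇ_)
open import Data.Bool using (Bool; true; false; if_then_else_; not; _∨_; _∧_)
open import Data.Fin using (Fin; zero; suc)
open import Data.Fin.Subset using (Subset; _⊆_; _∩_; _∪_; ∣_∣; ⊥)
open import Data.Vec using (lookup; tabulate)
open import Data.Integer as ℤ using (ℤ)
open import Relation.Binary.PropositionalEquality using (_≡_)

sumFin : (n : ℕ) → (Fin n → ℕ) → ℕ
sumFin zero    f = 0
sumFin (suc n) f = f zero + sumFin n (λ i → f (suc i))

anyFin : (n : ℕ) → (Fin n → Bool) → Bool
anyFin zero    f = false
anyFin (suc n) f = f zero ∨ anyFin n (λ i → f (suc i))

m̃ : {n : ℕ} → (Fin n → ℕ) → Subset n → ℕ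
m̃ {n} m X = sumFin n (λ v → if lookup X v then m v else 0)

-- A simple bigraph on S = Fin n, T = Fin k: adjacency relation.
SimpleBigraph : ℕ → ℕ → Set
SimpleBigraph n k = Fin n → Fin k → Bool

-- A bigraph possibly with parallel edges: multiplicity of each pair st.
Bigraph : ℕ → ℕ → Set
Bigraph n k = Fin n → Fin k → ℕ

bipComplement : {n k : ℕ} → SimpleBigraph n k → SimpleBigraph n k
bipComplement H s t = not (H s t)

dS : {n k : ℕ} → SimpleBigraph n k → Subset n → Subset k → ℕ
dS {n} {k} G X Y =
  sumFin n (λ s → sumFin k (λ t → if lookup X s ∧ lookup Y t ∧ G s t then 1 else 0))

Γ : {n k : ℕ} → SimpleBigraph n k → Subset k → Subset n
Γ {n} {k} H Y = tabulate (λ s → anyFin k (λ t → lookup Y t ∧ H s t))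

_+ᴳ_ : {n k : ℕ} → Bigraph n k → SimpleBigraph n k → Bigraph n k
(G +ᴳ H) s t = G s t + (if H s t then 1 else 0)

IsSimple : {n k : ℕ} → Bigraph n k → Set
IsSimple G = ∀ s t → G s t ≤ 1

support : {n k : ℕ} → Bigraph n k → SimpleBigraph n k
support G s t = not (G s t ≡ᵇ 0)

degS : {n k : ℕ} → Bigraph n k → Fin n → ℕ
degS {n} {k} G s = sumFin k (λ t → G s t)

degT : {n k : ℕ} → Bigraph n k → Fin k → ℕ
degT {n} {k} G t = sumFin n (λ s → G s t)

Fits : {n k : ℕ} → Bigraph n k → (Fin n → ℕ) → (Fin k → ℕ) → Set
Fits G mS mT = (∀ s → degS G s ≡ mS s) × (∀ t → degT G t ≡ mT t)
  where open import Data.Product using (_×_)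

record Matroid (n : ℕ) : Set where
  field
    rank       : Subset n → ℕ
    rank-≤-card : ∀ X → rank X ≤ ∣ X ∣
    rank-mono  : ∀ {X Y} → X ⊆ Y → rank X ≤ rank Y
    rank-submod : ∀ X Y → rank (X ∪ Y) + rank (X ∩ Y) ≤ rank X + rank Y

FullySupermodular : {k : ℕ} → (Subset k → ℤ) → Set
FullySupermodular {k} p =
  ∀ A B → p A ℤ.+ p B ℤ.≤ p (A ∩ B) ℤ.+ p (A ∪ B)

Covers : {n k : ℕ} → Matroid n → Bigraph n k → (Subset k → ℤ) → Set
Covers M G p = ∀ Y → p Y ℤ.≤ ℤ.+ (Matroid.rank M (Γ (support G) Y))

{-# OPTIONS --safe #-}

-- Let E₀ be the complement of H₀ and C(X , Z) = m(Z) − m(X) + d_{E₀}(X , T − Z); the first condition says C ≥ 0,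
-- the second p(T₀) ≤ C(X , Z) + r(X ∪ Γ(T₀)) for T₀ ⊆ Z.  The right-hand side is submodular in all its arguments,
-- so discrete separation (a supermodular function below a submodular one has an integral modular function in
-- between) replaces p by a vector ν, then r by 0/1 vectors u₁ , u₂ whose sum is below r, and splits ν = v₁ + v₂,
-- in such a way that the supply–demand theorem provides
--   E ⊆ E₀ with degrees m,   B ⊆ E₀ with degrees m − (u₁ , v₁),   F ⊆ H₀ with degrees (u₂ , v₂).
-- Regard E − B as a flow from T to S: an edge of E is an arc from T to S, a pair of E₀ − E an arc from S to T.
-- A unit of this flow going from t to s is traded for the single edge st, which joins F: if st lies in H₀ or in E
-- the flow unit is dropped; otherwise E is switched along the flow path closed up by st, unless the flow itself
-- uses st, and then the closed path is dropped.  Each trade shortens the flow.  In the end F ⊆ E ∪ H₀ has degrees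
-- at most u₁ + u₂ on S and ν on T, so E ∪ H₀ covers ν ≥ p.

module Submission where

open import Defs
open import Data.Nat using (ℕ; _<_)
open import Data.Fin using (Fin)
open import Data.Fin.Subset using (Subset; _⊆_; _∪_; ∁; ⊤)
open import Data.Integer as ℤ using (ℤ; +_; _-_; _≤_)
open import Data.Product using (_×_; Σ)
open import Function.Bundles using (_⇔_)
open import Relation.Binary.PropositionalEquality using (_≡_)

open import Data.Bool using (Bool; true; false; if_then_else_; not; _∧_; _∨_; _xor_)
import Data.Bool.Properties as Bool
open import Data.Fin using (zero; suc; _≟_; _↑ˡ_; _↑ʳ_)
open import Data.Fin.Properties using (any?)
open import Data.Fin.Subset using (_∩_; ⊥; ⁅_⁆; ∣_∣)
open import Data.Fin.Subset.Properties using (drop-∷-⊆; out⊆; s⊆s; ⊥⊆; ⊆⊤; ∣⊥∣≡0; ∣⁅x⁆∣≡1; ∪-idem; ∪-identityˡ; ∩-zeroˡ; p⊆p∪q; q⊆p∪q; p∩q⊆p; p∩q⊆q; x∈p∪q⁺; x∈p∪q⁻; x∈p∩q⁺; x∈p∩q⁻; x∈p⇒x∉∁p; x∉p⇒x∈∁p)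
open import Data.Integer using (0ℤ; 1ℤ; _+_; -_; _*_; _⊓_; _⊔_; +≤+; -[1+_])
open import Data.Integer.Properties hiding (_≟_)
open import Data.Integer.Tactic.RingSolver using (solve-∀)
open import Data.Nat as ℕ using (zero; suc; _≡ᵇ_)
import Data.Nat.Properties as ℕ
open import Data.Product using (∃; ∃₂; _,_; proj₁; proj₂)
open import Data.Sum using (_⊎_; inj₁; inj₂; [_,_]′)
open import Data.Vec using ([]; _∷_; lookup; tabulate; take; drop; _++_; here; there)
open import Data.Vec.Properties using (lookup-zipWith; lookup-map; lookup∘tabulate; lookup⇒[]=; []=⇒lookup; take-zipWith; drop-zipWith)
open import Function using (_∘_; id; case_of_)
open import Function.Bundles using (mk⇔)
open import Relation.Binary.PropositionalEquality using (refl; sym; trans; cong; cong₂; subst; subst₂; module ≡-Reasoning)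
open import Relation.Nullary using (¬_; yes; no; does; contradiction; _×-dec_)
open import Relation.Nullary.Decidable using (dec-true)
open import Algebra.Properties.CommutativeMonoid.Sum +-0-commutativeMonoid using (sum; sum-cong-≗; ∑-distrib-+; ∑-comm)

-- If `B` were contained in `E`, then E - B together with `F` would have degrees (u₁ + u₂ , ν) and
-- nothing would remain to be done. But the supply-demand theorem yields `E` and `B` independently,
-- and nothing makes them nested. Hence the flow, and hence `E` itself has to change on the way.
-- There are two vectors below the rank because T₀ can be covered in two ways, through new edges and
-- through H₀. The function r(X ∪ W) with X and W unrelated is submodular on two copies of S, and a
-- modular function below it is a pair (u₁ , u₂); putting X = W shows that u₁ + u₂ is below r. In
-- particular u₁ + u₂ ≤ 1 at each vertex, so a vertex that can still end a unit of flow has no edge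
-- of `F`, and the edge st to be added is new. Minimising some arguments away keeps submodularity
-- only if the arguments vary independently. The couplings T₀ ⊆ Z and W = Γ(T₀) are therefore given
-- up for the penalties m(T₀ - Z) and d(T₀ , S - W), the latter counted in H₀; each is at least what
-- the violation gains.

private
  variable
    n k : ℕ

-- Linear certificates: the difference of the two sides is written as a sum of known non-negative
-- gaps, an identity left to the ring solver as `eq`.
≤-from-gap : ∀ {i j e} → 0ℤ ≤ e → j - i ≡ e → i ≤ j
≤-from-gap 0≤e eq = 0≤i-j⇒j≤i (subst (0ℤ ≤_) (sym eq) 0≤e)

infixl 6 _⊹_
_⊹_ : ∀ {i j} → 0ℤ ≤ i → 0ℤ ≤ j → 0ℤ ≤ i + j
_⊹_ = +-mono-≤

gap : ∀ {i j} → i ≤ j → 0ℤ ≤ j - i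
gap = i≤j⇒0≤j-i

sum-mono : {f g : Fin n → ℤ} → (∀ i → f i ≤ g i) → sum f ≤ sum g
sum-mono {zero}  h = ≤-refl
sum-mono {suc n} h = +-mono-≤ (h zero) (sum-mono (h ∘ suc))

sum-0 : sum {n} (λ _ → 0ℤ) ≡ 0ℤ
sum-0 {zero}  = refl
sum-0 {suc n} = trans (+-identityˡ _) (sum-0 {n})

sum-≥0 : {f : Fin n → ℤ} → (∀ i → 0ℤ ≤ f i) → 0ℤ ≤ sum f
sum-≥0 {n} h = ≤-trans (≤-reflexive (sym (sum-0 {n}))) (sum-mono h)

-- Sums over finite sets

⟪_,_⟫ : (Fin n → ℤ) → Subset n → ℤ
⟪ u , X ⟫ = sum (λ i → if lookup X i then u i else 0ℤ)

⟪⟫-cong : {u v : Fin n → ℤ} → (∀ i → u i ≡ v i) → ∀ X → ⟪ u , X ⟫ ≡ ⟪ v , X ⟫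
⟪⟫-cong h X = sum-cong-≗ (λ i → cong (λ z → if lookup X i then z else 0ℤ) (h i))

⟪⟫-+ : ∀ (u v : Fin n → ℤ) X → ⟪ (λ i → u i + v i) , X ⟫ ≡ ⟪ u , X ⟫ + ⟪ v , X ⟫
⟪⟫-+ u v X = trans (sum-cong-≗ pt) (∑-distrib-+ (λ i → if lookup X i then u i else 0ℤ) (λ i → if lookup X i then v i else 0ℤ))
  where
  pt : ∀ i → (if lookup X i then u i + v i else 0ℤ) ≡
             (if lookup X i then u i else 0ℤ) + (if lookup X i then v i else 0ℤ)
  pt i with lookup X i
  ... | true  = refl
  ... | false = refl

⟪⟫-neg : ∀ (u : Fin n → ℤ) X → ⟪ (λ i → - u i) , X ⟫ ≡ - ⟪ u , X ⟫
⟪⟫-neg u []          = refl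
⟪⟫-neg u (true ∷ X)  = trans (cong (λ z → - u zero + z) (⟪⟫-neg (u ∘ suc) X)) (sym (neg-distrib-+ (u zero) ⟪ u ∘ suc , X ⟫))
⟪⟫-neg u (false ∷ X) = trans (cong (λ z → 0ℤ + z) (⟪⟫-neg (u ∘ suc) X)) (sym (neg-distrib-+ 0ℤ ⟪ u ∘ suc , X ⟫))

⟪⟫-- : ∀ (u v : Fin n → ℤ) X → ⟪ (λ i → u i - v i) , X ⟫ ≡ ⟪ u , X ⟫ - ⟪ v , X ⟫
⟪⟫-- u v X = trans (⟪⟫-+ u (λ i → - v i) X) (cong (λ z → ⟪ u , X ⟫ + z) (⟪⟫-neg v X))

⟪⟫-mono : {u v : Fin n → ℤ} → (∀ i → u i ≤ v i) → ∀ X → ⟪ u , X ⟫ ≤ ⟪ v , X ⟫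
⟪⟫-mono {u = u} {v} h X = sum-mono pt
  where
  pt : ∀ i → (if lookup X i then u i else 0ℤ) ≤ (if lookup X i then v i else 0ℤ)
  pt i with lookup X i
  ... | true  = h i
  ... | false = ≤-refl

⟪⟫-≥0 : {u : Fin n → ℤ} → (∀ i → 0ℤ ≤ u i) → ∀ X → 0ℤ ≤ ⟪ u , X ⟫
⟪⟫-≥0 {u = u} h X = sum-≥0 pt
  where
  pt : ∀ i → 0ℤ ≤ (if lookup X i then u i else 0ℤ)
  pt i with lookup X i
  ... | true  = h i
  ... | false = ≤-refl

⟪⟫-⊥ : ∀ (u : Fin n → ℤ) → ⟪ u , ⊥ ⟫ ≡ 0ℤ
⟪⟫-⊥ {zero}  u = refl
⟪⟫-⊥ {suc n} u = trans (+-identityˡ _) (⟪⟫-⊥ (u ∘ suc))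

⟪⟫-⊤ : ∀ (u : Fin n → ℤ) → ⟪ u , ⊤ ⟫ ≡ sum u
⟪⟫-⊤ {zero}  u = refl
⟪⟫-⊤ {suc n} u = cong (λ z → u zero + z) (⟪⟫-⊤ (u ∘ suc))

⟪⟫-∁ : ∀ (u : Fin n → ℤ) X → ⟪ u , X ⟫ + ⟪ u , ∁ X ⟫ ≡ sum u
⟪⟫-∁ u []          = refl
⟪⟫-∁ u (true ∷ X)  = trans (eq (u zero) ⟪ u ∘ suc , X ⟫ ⟪ u ∘ suc , ∁ X ⟫) (cong (λ z → u zero + z) (⟪⟫-∁ (u ∘ suc) X))
  where
  eq : ∀ a b c → (a + b) + (0ℤ + c) ≡ a + (b + c)
  eq = solve-∀
⟪⟫-∁ u (false ∷ X) = trans (eq (u zero) ⟪ u ∘ suc , X ⟫ ⟪ u ∘ suc , ∁ X ⟫) (cong (λ z → u zero + z) (⟪⟫-∁ (u ∘ suc) X))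
  where
  eq : ∀ a b c → (0ℤ + b) + (a + c) ≡ a + (b + c)
  eq = solve-∀

⟪⟫-modular : ∀ (u : Fin n → ℤ) X Y → ⟪ u , X ∩ Y ⟫ + ⟪ u , X ∪ Y ⟫ ≡ ⟪ u , X ⟫ + ⟪ u , Y ⟫
⟪⟫-modular u []      []      = refl
⟪⟫-modular u (x ∷ X) (y ∷ Y) =
  trans (+-exchange (w (x ∧ y)) ⟪ u ∘ suc , X ∩ Y ⟫ (w (x ∨ y)) ⟪ u ∘ suc , X ∪ Y ⟫)
    (trans (cong₂ _+_ (pt x y) (⟪⟫-modular (u ∘ suc) X Y))
      (+-exchange (w x) (w y) ⟪ u ∘ suc , X ⟫ ⟪ u ∘ suc , Y ⟫))
  where
  +-exchange : ∀ a b c d → (a + b) + (c + d) ≡ (a + c) + (b + d)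
  +-exchange = solve-∀
  w : Bool → ℤ
  w b = if b then u zero else 0ℤ
  pt : ∀ x y → w (x ∧ y) + w (x ∨ y) ≡ w x + w y
  pt true  true  = refl
  pt true  false = +-comm 0ℤ (u zero)
  pt false y     = refl

-- Submodularity

-- The lattice laws play no role, only the two operations do.
record Lat : Set₁ where
  constructor lat
  field
    El      : Set
    _⋏_ _⋎_ : El → El → El

open Lat using (El)

𝟚^ : ℕ → Lat
𝟚^ n = lat (Subset n) _∩_ _∪_

infixr 5 _⊗_
_⊗_ : Lat → Lat → Lat
lat A _∧₁_ _∨₁_ ⊗ lat B _∧₂_ _∨₂_ =
  lat (A × B) (λ { (a , b) (a′ , b′) → (a ∧₁ a′) , (b ∧₂ b′) })
              (λ { (a , b) (a′ , b′) → (a ∨₁ a′) , (b ∨₂ b′) })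

Submodular : (L : Lat) → (El L → ℤ) → Set
Submodular L f = ∀ x y → f (x ⋏ y) + f (x ⋎ y) ≤ f x + f y
  where open Lat L

dual : Lat → Lat
dual (lat A _∧₁_ _∨₁_) = lat A _∨₁_ _∧₁_

submodular-+ : ∀ L {f g} → Submodular L f → Submodular L g → Submodular L (λ x → f x + g x)
submodular-+ L {f} {g} sf sg x y =
  ≤-from-gap (gap (sf x y) ⊹ gap (sg x y))
    (eq (f (x ⋏ y)) (f (x ⋎ y)) (f x) (f y) (g (x ⋏ y)) (g (x ⋎ y)) (g x) (g y))
  where
  open Lat L
  eq : ∀ a b c d a′ b′ c′ d′ → ((c + c′) + (d + d′)) - ((a + a′) + (b + b′)) ≡ ((c + d) - (a + b)) + ((c′ + d′) - (a′ + b′))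
  eq = solve-∀

⟪⟫-submodular : ∀ (u : Fin n → ℤ) → Submodular (𝟚^ n) ⟪ u ,_⟫
⟪⟫-submodular u X Y = ≤-reflexive (⟪⟫-modular u X Y)

-- A `Lat` carries no order, so monotonicity is phrased through the meet; over `dual` the same
-- hypotheses say that `f` is antitone. When one of the two values exceeds `k`, the join is charged
-- to `k` and the meet to the other value.
submodular-⊓ : ∀ L {f} k → let open Lat L in Submodular L f → (∀ x y → f (x ⋏ y) ≤ f x) → (∀ x y → f (x ⋏ y) ≤ f y) →
               Submodular L (λ x → f x ⊓ k)
submodular-⊓ L {f} k sf f⋏ˡ f⋏ʳ x y with ≤-total (f x) k | ≤-total (f y) k
... | inj₂ k≤fx | _ rewrite i≥j⇒i⊓j≡j k≤fx | +-comm k (f y ⊓ k) = +-mono-≤ (⊓-monoˡ-≤ k (f⋏ʳ x y)) (i⊓j≤j _ k)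
... | inj₁ fx≤k | inj₂ k≤fy rewrite i≥j⇒i⊓j≡j k≤fy = +-mono-≤ (⊓-monoˡ-≤ k (f⋏ˡ x y)) (i⊓j≤j _ k)
... | inj₁ fx≤k | inj₁ fy≤k rewrite i≤j⇒i⊓j≡i fx≤k | i≤j⇒i⊓j≡i fy≤k =
  ≤-trans (+-mono-≤ (i⊓j≤i (f (x ⋏ y)) k) (i⊓j≤i (f (x ⋎ y)) k)) (sf x y)
  where open Lat L

minS : (Subset n → ℤ) → ℤ
minS {zero}  f = f []
minS {suc n} f = minS (f ∘ (true ∷_)) ⊓ minS (f ∘ (false ∷_))

minS-≤ : ∀ (f : Subset n → ℤ) X → minS f ≤ f X
minS-≤ f []          = ≤-refl
minS-≤ f (true ∷ X)  = ≤-trans (i⊓j≤i _ _) (minS-≤ (f ∘ (true ∷_)) X)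
minS-≤ f (false ∷ X) = ≤-trans (i⊓j≤j (minS (f ∘ (true ∷_))) _) (minS-≤ (f ∘ (false ∷_)) X)

minS-attained : ∀ (f : Subset n → ℤ) → ∃ λ X → minS f ≡ f X
minS-attained {zero}  f = [] , refl
minS-attained {suc n} f with ⊓-sel (minS (f ∘ (true ∷_))) (minS (f ∘ (false ∷_)))
... | inj₁ eq = let X , e = minS-attained (f ∘ (true ∷_)) in true ∷ X , trans eq e
... | inj₂ eq = let X , e = minS-attained (f ∘ (false ∷_)) in false ∷ X , trans eq e

minS-glb : ∀ (f : Subset n → ℤ) {z} → (∀ X → z ≤ f X) → z ≤ minS f
minS-glb f h = let X , e = minS-attained f in subst (_ ≤_) (sym e) (h X)

-- Projection along a factor: the intersection and the union of two minimisers are candidates for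
-- the minima at meet and join.
minS-submodular : ∀ L f → Submodular (L ⊗ 𝟚^ n) f → Submodular L (λ x → minS (λ X → f (x , X)))
minS-submodular L f sf x y with minS-attained (λ X → f (x , X)) | minS-attained (λ X → f (y , X))
... | X , eX | Y , eY rewrite eX | eY =
  ≤-trans (+-mono-≤ (minS-≤ _ (X ∩ Y)) (minS-≤ _ (X ∪ Y))) (sf (x , X) (y , Y))

-- The weight of the first element is eliminated: both functions are projected along it, and the bounds that b and q
-- impose on it are compatible by uncrossing.
separation : ∀ {n} (b q : Subset n → ℤ) → Submodular (𝟚^ n) b → Submodular (𝟚^ n) q →
             b ⊥ ≡ 0ℤ → (∀ A → 0ℤ ≤ b A + q A) →
             ∃ λ (m : Fin n → ℤ) → (∀ A → ⟪ m , A ⟫ ≤ b A) × (∀ A → - ⟪ m , A ⟫ ≤ q A)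
separation {zero}  b q _  _  b⊥ b+q =
  (λ ()) , (λ { [] → ≤-reflexive (sym b⊥) }) ,
  (λ { [] → subst (0ℤ ≤_) (trans (cong (_+ q []) b⊥) (+-identityˡ _)) (b+q []) })
separation {suc n} b q sb sq b⊥ b+q = m , m≤b , -m≤q
  where
  -a a : ℤ
  -- `a` is the least value that the lower bounds permit: - m(A) ≤ q(true ∷ A) + a has to be
  -- compatible with m(A) ≤ b(false ∷ A).
  -a = minS (λ A → q (true ∷ A) + b (false ∷ A))
  a  = - -a
  C  = proj₁ (minS-attained (λ A → q (true ∷ A) + b (false ∷ A)))
  -a≡ : -a ≡ q (true ∷ C) + b (false ∷ C)
  -a≡ = proj₂ (minS-attained (λ A → q (true ∷ A) + b (false ∷ A)))

  shift : ℤ → Bool → ℤ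
  shift z true  = z
  shift z false = 0ℤ

  -- The first element becomes a separate factor, so that minimising over it is an instance of
  -- `minS-submodular`.
  shifted : (Subset (suc n) → ℤ) → ℤ → Subset n × Subset 1 → ℤ
  shifted f z (A , x ∷ []) = f (x ∷ A) + shift z x

  shifted-submodular : ∀ f z → Submodular (𝟚^ (suc n)) f → Submodular (𝟚^ n ⊗ 𝟚^ 1) (shifted f z)
  shifted-submodular f z sf (A , x ∷ []) (B , y ∷ []) =
    ≤-from-gap (gap (sf (x ∷ A) (y ∷ B)))
      (trans (eq f∩ f∪ (f (x ∷ A)) (f (y ∷ B)) (shift z (x ∧ y)) (shift z (x ∨ y)) (shift z x) (shift z y))
        (trans (cong (λ w → f (x ∷ A) + f (y ∷ B) - (f∩ + f∪) + w) (pt x y)) (+-identityʳ _)))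
    where
    f∩ f∪ : ℤ
    f∩ = f ((x ∧ y) ∷ (A ∩ B))
    f∪ = f ((x ∨ y) ∷ (A ∪ B))
    eq : ∀ c d e f c′ d′ e′ f′ → ((e + e′) + (f + f′)) - ((c + c′) + (d + d′)) ≡ ((e + f) - (c + d)) + ((e′ + f′) - (c′ + d′))
    eq = solve-∀
    pt : ∀ x y → (shift z x + shift z y) - (shift z (x ∧ y) + shift z (x ∨ y)) ≡ 0ℤ
    pt true  true  = i≡j⇒i-j≡0 (refl {x = z + z})
    pt true  false = i≡j⇒i-j≡0 (+-comm z 0ℤ)
    pt false y     = i≡j⇒i-j≡0 (refl {x = 0ℤ + shift z y})

  b′ q′ : Subset n → ℤ
  b′ A = minS (λ X → shifted b -a (A , X))
  q′ A = minS (λ X → shifted q a (A , X))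

  -- The pair true ∷ A , false ∷ C, used for `b`, and the pair false ∷ A , true ∷ C, used for `q`,
  -- have the same intersection and the same union, and b + q ≥ 0 there.
  b₁-a : ∀ A → 0ℤ ≤ b (true ∷ A) + -a + q (false ∷ A)
  b₁-a A rewrite -a≡ = ≤-trans (b+q (false ∷ A ∩ C) ⊹ b+q (true ∷ A ∪ C))
    (≤-from-gap (gap (sb (true ∷ A) (false ∷ C)) ⊹ gap (sq (false ∷ A) (true ∷ C)))
      (eq (b (true ∷ A)) (b (false ∷ C)) (q (false ∷ A)) (q (true ∷ C))
        (b (false ∷ A ∩ C)) (b (true ∷ A ∪ C)) (q (false ∷ A ∩ C)) (q (true ∷ A ∪ C))))
    where
    eq : ∀ b1 b0 q0 q1 bm bj qm qj → (b1 + (q1 + b0) + q0) - ((bm + qm) + (bj + qj)) ≡ ((b1 + b0) - (bm + bj)) + ((q0 + q1) - (qm + qj))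
    eq = solve-∀

  b₀+a : ∀ A → 0ℤ ≤ b (false ∷ A) + (q (true ∷ A) + a)
  b₀+a A = ≤-from-gap (gap (minS-≤ (λ A → q (true ∷ A) + b (false ∷ A)) A)) (eq (b (false ∷ A)) (q (true ∷ A)) -a)
    where
    eq : ∀ b0 q1 z → (b0 + (q1 + - z)) - 0ℤ ≡ (q1 + b0) - z
    eq = solve-∀

  b′+q′ : ∀ A → 0ℤ ≤ b′ A + q′ A
  b′+q′ A with minS-attained (λ X → shifted b -a (A , X)) | minS-attained (λ X → shifted q a (A , X))
  ... | true  ∷ [] , e | true  ∷ [] , e′ rewrite e | e′ = ≤-from-gap (b+q (true ∷ A)) (eq (b (true ∷ A)) (q (true ∷ A)) -a)
    where
    eq : ∀ b1 q1 z → ((b1 + z) + (q1 + - z)) - 0ℤ ≡ b1 + q1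
    eq = solve-∀
  ... | true  ∷ [] , e | false ∷ [] , e′ rewrite e | e′ | +-identityʳ (q (false ∷ A)) = b₁-a A
  ... | false ∷ [] , e | true  ∷ [] , e′ rewrite e | e′ | +-identityʳ (b (false ∷ A)) = b₀+a A
  ... | false ∷ [] , e | false ∷ [] , e′ rewrite e | e′ | +-identityʳ (b (false ∷ A)) | +-identityʳ (q (false ∷ A)) = b+q (false ∷ A)

  -- The chosen `a` respects the bound of `b` on the first element alone; this keeps `b′` zero at
  -- `⊥` for the recursion.
  b₁⊥ : 0ℤ ≤ b (true ∷ ⊥) + -a
  b₁⊥ rewrite -a≡ = ≤-from-gap (b+q (true ∷ C) ⊹ gap step ⊹ ≤-reflexive (sym b⊥))
    (eq (b (true ∷ ⊥)) (q (true ∷ C)) (b (false ∷ C)) (b (true ∷ C)) (b (false ∷ ⊥)))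
    where
    step : b (false ∷ ⊥) + b (true ∷ C) ≤ b (true ∷ ⊥) + b (false ∷ C)
    step = subst (_≤ b (true ∷ ⊥) + b (false ∷ C)) (cong₂ (λ X Y → b (false ∷ X) + b (true ∷ Y)) (∩-zeroˡ C) (∪-identityˡ C)) (sb (true ∷ ⊥) (false ∷ C))
    eq : ∀ b1 q1 b0 bC z → (b1 + (q1 + b0)) - 0ℤ ≡ ((bC + q1) + ((b1 + b0) - (z + bC))) + z
    eq = solve-∀

  b′⊥ : b′ ⊥ ≡ 0ℤ
  b′⊥ = trans (i≥j⇒i⊓j≡j (≤-trans (≤-reflexive e) b₁⊥)) e
    where
    e : b (false ∷ ⊥) + 0ℤ ≡ 0ℤ
    e = trans (+-identityʳ _) b⊥

  rec = separation b′ q′ (minS-submodular (𝟚^ n) (shifted b -a) (shifted-submodular b -a sb))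
                         (minS-submodular (𝟚^ n) (shifted q a) (shifted-submodular q a sq)) b′⊥ b′+q′
  m′ = proj₁ rec
  m : Fin (suc n) → ℤ
  m zero    = a
  m (suc i) = m′ i

  m≤b : ∀ A → ⟪ m , A ⟫ ≤ b A
  m≤b (true ∷ A) = ≤-from-gap (gap (≤-trans (proj₁ (proj₂ rec) A) (minS-≤ (λ X → shifted b -a (A , X)) (true ∷ []))))
    (eq (b (true ∷ A)) ⟪ m′ , A ⟫ -a)
    where
    eq : ∀ b1 w z → b1 - (- z + w) ≡ (b1 + z) - w
    eq = solve-∀
  m≤b (false ∷ A) = ≤-from-gap (gap (≤-trans (proj₁ (proj₂ rec) A) (minS-≤ (λ X → shifted b -a (A , X)) (false ∷ []))))
    (eq (b (false ∷ A)) ⟪ m′ , A ⟫)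
    where
    eq : ∀ b0 w → b0 - (0ℤ + w) ≡ (b0 + 0ℤ) - w
    eq = solve-∀

  -m≤q : ∀ A → - ⟪ m , A ⟫ ≤ q A
  -m≤q (true ∷ A) = ≤-from-gap (gap (≤-trans (proj₂ (proj₂ rec) A) (minS-≤ (λ X → shifted q a (A , X)) (true ∷ []))))
    (eq (q (true ∷ A)) ⟪ m′ , A ⟫ a)
    where
    eq : ∀ q1 w z → q1 - (- (z + w)) ≡ (q1 + z) - (- w)
    eq = solve-∀
  -m≤q (false ∷ A) = ≤-from-gap (gap (≤-trans (proj₂ (proj₂ rec) A) (minS-≤ (λ X → shifted q a (A , X)) (false ∷ []))))
    (eq (q (false ∷ A)) ⟪ m′ , A ⟫)
    where
    eq : ∀ q0 w → q0 - (- (0ℤ + w)) ≡ (q0 + 0ℤ) - (- w)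
    eq = solve-∀

-- Non-negative separation under a monotone bound

Monotone : (Subset n → ℤ) → Set
Monotone b = ∀ {A B} → A ⊆ B → b A ≤ b B

⟪⟫-⊔0-attained : ∀ (m : Fin n → ℤ) A → ∃ λ B → B ⊆ A × ⟪ (λ i → m i ⊔ 0ℤ) , A ⟫ ≡ ⟪ m , B ⟫
⟪⟫-⊔0-attained m []          = [] , id , refl
⟪⟫-⊔0-attained m (false ∷ A) =
  let B , B⊆A , e = ⟪⟫-⊔0-attained (m ∘ suc) A in false ∷ B , s⊆s B⊆A , cong (λ z → 0ℤ + z) e
⟪⟫-⊔0-attained m (true ∷ A) with ⟪⟫-⊔0-attained (m ∘ suc) A | ⊔-sel (m zero) 0ℤ
... | B , B⊆A , e | inj₁ e₀ = true ∷ B , s⊆s B⊆A , cong₂ _+_ e₀ e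
... | B , B⊆A , e | inj₂ e₀ = false ∷ B , out⊆ B⊆A , cong₂ _+_ e₀ e

-- The positive part of `m` weighs on `A` what `m` weighs on a subset of `A`, so a monotone bound
-- survives.
⟪⟫-⊔0-≤ : ∀ (m : Fin n → ℤ) (b : Subset n → ℤ) → Monotone b → (∀ A → ⟪ m , A ⟫ ≤ b A) →
          ∀ A → ⟪ (λ i → m i ⊔ 0ℤ) , A ⟫ ≤ b A
⟪⟫-⊔0-≤ m b mono m≤b A =
  let B , B⊆A , e = ⟪⟫-⊔0-attained m A in ≤-trans (≤-reflexive e) (≤-trans (m≤b B) (mono B⊆A))

separation⁺ : ∀ (b q : Subset n → ℤ) → Submodular (𝟚^ n) b → Submodular (𝟚^ n) q → Monotone b →
              b ⊥ ≡ 0ℤ → (∀ A → 0ℤ ≤ b A + q A) →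
              ∃ λ (m : Fin n → ℤ) → (∀ i → 0ℤ ≤ m i) × (∀ A → ⟪ m , A ⟫ ≤ b A) × (∀ A → - ⟪ m , A ⟫ ≤ q A)
separation⁺ b q sb sq mono b⊥ b+q with separation b q sb sq b⊥ b+q
... | m , m≤b , -m≤q = (λ i → m i ⊔ 0ℤ) , (λ i → i≤j⊔i (m i) 0ℤ) , ⟪⟫-⊔0-≤ m b mono m≤b ,
  λ A → ≤-trans (neg-mono-≤ (⟪⟫-mono (λ i → i≤i⊔j (m i) 0ℤ) A)) (-m≤q A)

⟪⟫-monotone : {u : Fin n → ℤ} → (∀ i → 0ℤ ≤ u i) → Monotone ⟪ u ,_⟫
⟪⟫-monotone h {[]}        {[]}        _   = ≤-refl
⟪⟫-monotone {u = u} h {true ∷ A} {true ∷ B} A⊆B = +-monoʳ-≤ (u zero) (⟪⟫-monotone (h ∘ suc) (drop-∷-⊆ A⊆B))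
⟪⟫-monotone h {true ∷ A}  {false ∷ B} A⊆B = case A⊆B here of λ ()
⟪⟫-monotone h {false ∷ A} {true ∷ B}  A⊆B = +-mono-≤ (h zero) (⟪⟫-monotone (h ∘ suc) (drop-∷-⊆ A⊆B))
⟪⟫-monotone h {false ∷ A} {false ∷ B} A⊆B = +-monoʳ-≤ 0ℤ (⟪⟫-monotone (h ∘ suc) (drop-∷-⊆ A⊆B))

⟪⟫-⁅⁆ : ∀ (u : Fin n → ℤ) i → ⟪ u , ⁅ i ⁆ ⟫ ≡ u i
⟪⟫-⁅⁆ u zero    = trans (cong (λ z → u zero + z) (⟪⟫-⊥ (u ∘ suc))) (+-identityʳ _)
⟪⟫-⁅⁆ u (suc i) = trans (+-identityˡ _) (⟪⟫-⁅⁆ (u ∘ suc) i)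

⟪⟫-∁-≡ : ∀ (u : Fin n → ℤ) X → ⟪ u , ∁ X ⟫ ≡ sum u - ⟪ u , X ⟫
⟪⟫-∁-≡ u X = trans (eq ⟪ u , X ⟫ ⟪ u , ∁ X ⟫) (cong (_- ⟪ u , X ⟫) (⟪⟫-∁ u X))
  where
  eq : ∀ a b → b ≡ (a + b) - a
  eq = solve-∀

⟪⟫-∁∁ : ∀ (u : Fin n → ℤ) X → ⟪ u , ∁ (∁ X) ⟫ ≡ ⟪ u , X ⟫
⟪⟫-∁∁ u X = trans (⟪⟫-∁-≡ u (∁ X)) (trans (cong (λ z → sum u - z) (⟪⟫-∁-≡ u X)) (eq (sum u) ⟪ u , X ⟫))
  where
  eq : ∀ a b → a - (a - b) ≡ b
  eq = solve-∀

⟪⟫-∁⊤ : ∀ (u : Fin n → ℤ) → ⟪ u , ∁ ⊤ ⟫ ≡ 0ℤ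
⟪⟫-∁⊤ u = trans (⟪⟫-∁-≡ u ⊤) (i≡j⇒i-j≡0 (sym (⟪⟫-⊤ u)))

⟪⟫-0 : ∀ {u : Fin n → ℤ} → (∀ i → u i ≡ 0ℤ) → ∀ X → ⟪ u , X ⟫ ≡ 0ℤ
⟪⟫-0 {n} {u} h X = trans (sum-cong-≗ pt) (sum-0 {n})
  where
  pt : ∀ i → (if lookup X i then u i else 0ℤ) ≡ 0ℤ
  pt i with lookup X i
  ... | true  = h i
  ... | false = refl

-- Submodularity of cuts

record ModularAntitone (L : Lat) (h : El L → ℤ) : Set where
  open Lat L using (_⋏_; _⋎_)
  field
    modular  : ∀ x y → h (x ⋏ y) + h (x ⋎ y) ≡ h x + h y
    antitone : ∀ x y → h (x ⋎ y) ≤ h x × h (x ⋎ y) ≤ h y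

open ModularAntitone

-- Element by element: one that lies in both sets is settled by modularity; one that lies in a
-- single set reappears only in the union, weighted at the join, where the antitone weight is no
-- larger.
⟪⟫-⊗-submodular : ∀ L (h : Fin n → El L → ℤ) → (∀ s → ModularAntitone L (h s)) →
                  Submodular (𝟚^ n ⊗ L) (λ { (X , z) → ⟪ (λ s → h s z) , X ⟫ })
⟪⟫-⊗-submodular L h ma ([] , z) ([] , z′) = ≤-refl
⟪⟫-⊗-submodular L h ma (x ∷ X , z) (y ∷ Y , z′) =
  ≤-from-gap (gap (pt x y) ⊹ gap (⟪⟫-⊗-submodular L (h ∘ suc) (ma ∘ suc) (X , z) (Y , z′)))
    (eq (w (x ∧ y) (z ⋏ z′)) ⟪ h′ (z ⋏ z′) , X ∩ Y ⟫ (w (x ∨ y) (z ⋎ z′)) ⟪ h′ (z ⋎ z′) , X ∪ Y ⟫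
        (w x z) ⟪ h′ z , X ⟫ (w y z′) ⟪ h′ z′ , Y ⟫)
  where
  open Lat L using (_⋏_; _⋎_)
  h′ : El L → Fin _ → ℤ
  h′ z s = h (suc s) z
  w : Bool → El L → ℤ
  w b z = if b then h zero z else 0ℤ
  pt : ∀ x y → w (x ∧ y) (z ⋏ z′) + w (x ∨ y) (z ⋎ z′) ≤ w x z + w y z′
  pt true  true  = ≤-reflexive (modular (ma zero) z z′)
  pt true  false = ≤-trans (≤-reflexive (+-identityˡ _)) (≤-trans (proj₁ (antitone (ma zero) z z′)) (≤-reflexive (sym (+-identityʳ _))))
  pt false true  = ≤-trans (≤-reflexive (+-identityˡ _)) (≤-trans (proj₂ (antitone (ma zero) z z′)) (≤-reflexive (sym (+-identityˡ _))))
  pt false false = ≤-refl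
  eq : ∀ a a′ b b′ c c′ d d′ → ((c + c′) + (d + d′)) - ((a + a′) + (b + b′)) ≡ ((c + d) - (a + b)) + ((c′ + d′) - (a′ + b′))
  eq = solve-∀

-- The weight of the edges from `X` to the outside of `Z`. The complement in the second argument is
-- what makes it jointly submodular, as the cut function of a digraph.
cut : (Fin n → Fin k → ℤ) → Subset n → Subset k → ℤ
cut M X Z = ⟪ (λ s → ⟪ M s , ∁ Z ⟫) , X ⟫

⟪⟫∁-modularAntitone : ∀ (u : Fin n → ℤ) → (∀ i → 0ℤ ≤ u i) → ModularAntitone (𝟚^ n) (λ Z → ⟪ u , ∁ Z ⟫)
⟪⟫∁-modularAntitone u u≥0 = record { modular = mod ; antitone = λ X Y → anti {X} (p⊆p∪q Y) , anti {Y} (q⊆p∪q X Y) }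
  where
  mod : ∀ X Y → ⟪ u , ∁ (X ∩ Y) ⟫ + ⟪ u , ∁ (X ∪ Y) ⟫ ≡ ⟪ u , ∁ X ⟫ + ⟪ u , ∁ Y ⟫
  mod X Y rewrite ⟪⟫-∁-≡ u (X ∩ Y) | ⟪⟫-∁-≡ u (X ∪ Y) | ⟪⟫-∁-≡ u X | ⟪⟫-∁-≡ u Y =
    trans (eq (sum u) ⟪ u , X ∩ Y ⟫ ⟪ u , X ∪ Y ⟫)
      (trans (cong (λ z → sum u + sum u - z) (⟪⟫-modular u X Y)) (sym (eq (sum u) ⟪ u , X ⟫ ⟪ u , Y ⟫)))
    where
    eq : ∀ s a b → (s - a) + (s - b) ≡ s + s - (a + b)
    eq = solve-∀
  anti : ∀ {X Y} → X ⊆ Y → ⟪ u , ∁ Y ⟫ ≤ ⟪ u , ∁ X ⟫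
  anti {X} {Y} X⊆Y rewrite ⟪⟫-∁-≡ u X | ⟪⟫-∁-≡ u Y = +-monoʳ-≤ (sum u) (neg-mono-≤ (⟪⟫-monotone u≥0 X⊆Y))

cut-submodular : ∀ (M : Fin n → Fin k → ℤ) → (∀ s t → 0ℤ ≤ M s t) → Submodular (𝟚^ n ⊗ 𝟚^ k) (λ { (X , Z) → cut M X Z })
cut-submodular M M≥0 = ⟪⟫-⊗-submodular (𝟚^ _) (λ s Z → ⟪ M s , ∁ Z ⟫) (λ s → ⟪⟫∁-modularAntitone (M s) (M≥0 s))

cut-≥0 : ∀ (M : Fin n → Fin k → ℤ) → (∀ s t → 0ℤ ≤ M s t) → ∀ X Z → 0ℤ ≤ cut M X Z
cut-≥0 M M≥0 X Z = ⟪⟫-≥0 (λ s → ⟪⟫-≥0 (M≥0 s) (∁ Z)) X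

cut-⊤ : ∀ (M : Fin n → Fin k → ℤ) X → cut M X ⊤ ≡ 0ℤ
cut-⊤ M X = ⟪⟫-0 (λ s → ⟪⟫-∁⊤ (M s)) X

⟦_⟧ : Bool → ℤ
⟦ true ⟧  = 1ℤ
⟦ false ⟧ = 0ℤ

⟦⟧-≥0 : ∀ b → 0ℤ ≤ ⟦ b ⟧
⟦⟧-≥0 true  = +≤+ ℕ.z≤n
⟦⟧-≥0 false = ≤-refl

⟦_⟧ᴹ : SimpleBigraph n k → Fin n → Fin k → ℤ
⟦ M ⟧ᴹ s t = ⟦ M s t ⟧

⟦⟧ᴹ-≥0 : (M : SimpleBigraph n k) → ∀ s t → 0ℤ ≤ ⟦ M ⟧ᴹ s t
⟦⟧ᴹ-≥0 M s t = ⟦⟧-≥0 (M s t)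

as-Bool : ∀ z e → 0ℤ ≤ z → z ≤ ⟦ e ⟧ → ∃ λ c → ⟦ c ⟧ ≡ z × (c ≡ true → e ≡ true)
as-Bool (+ 0)             e     _ _  = false , refl , λ ()
as-Bool (+ 1)             true  _ _  = true , refl , id
as-Bool (+ 1)             false _ (+≤+ ())
as-Bool (+ suc (suc _))   true  _ (+≤+ (ℕ.s≤s ()))
as-Bool (+ suc (suc _))   false _ (+≤+ ())
as-Bool -[1+ _ ]          _     () _

row : SimpleBigraph n k → Fin n → ℤ
row M s = sum (λ t → ⟦ M s t ⟧)

col : SimpleBigraph n k → Fin k → ℤ
col M t = sum (λ s → ⟦ M s t ⟧)

_⊑_ : SimpleBigraph n k → SimpleBigraph n k → Set
A ⊑ B = ∀ s t → A s t ≡ true → B s t ≡ true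

-- The supply–demand theorem

Transport : SimpleBigraph n k → (Fin n → ℤ) → (Fin k → ℤ) → Set
Transport E₀ a b = ∃ λ E → E ⊑ E₀ × (∀ s → row E s ≡ a s) × (∀ t → col E t ≡ b t)

-- The first row m has to satisfy a₀ − h(∁ Z) ≤ m(Z) for m ≤ h and the supply–demand condition of the remaining rows
-- as upper bound; the two bounds are separated.
transport : ∀ {n k} (E₀ : SimpleBigraph n k) (a : Fin n → ℤ) (b : Fin k → ℤ) → sum a ≡ sum b →
            (∀ X Z → ⟪ a , X ⟫ ≤ ⟪ b , Z ⟫ + cut ⟦ E₀ ⟧ᴹ X Z) → Transport E₀ a b
transport {zero}  {k} E₀ a b Σa≡Σb cond = (λ ()) , (λ ()) , (λ ()) , λ t → ≤-antisym (b≥0 t) (b≤0 t)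
  where
  b≥0 : ∀ t → 0ℤ ≤ b t
  b≥0 t = subst (0ℤ ≤_) (trans (+-identityʳ _) (⟪⟫-⁅⁆ b t)) (cond [] ⁅ t ⁆)
  b≤0 : ∀ t → b t ≤ 0ℤ
  b≤0 t = ≤-trans (≤-reflexive (sym (⟪⟫-⁅⁆ b t))) (≤-trans (⟪⟫-monotone b≥0 {⁅ t ⁆} ⊆⊤)
            (≤-reflexive (trans (⟪⟫-⊤ b) (sym Σa≡Σb))))
transport {suc n} {k} E₀ a b Σa≡Σb cond = E , E⊑E₀ , rows , cols
  where
  a₀ : ℤ
  a₀ = a zero
  a′ : Fin n → ℤ
  a′ = a ∘ suc
  h : Fin k → ℤ
  h t = ⟦ E₀ zero t ⟧
  cut′ : Subset n → Subset k → ℤ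
  cut′ = cut ⟦ E₀ ∘ suc ⟧ᴹ

  -- The supply-demand condition of the remaining rows, after the first row has used up `m`, reads
  -- m(Z) ≤ f Z X for all `X`.
  f : Subset k → Subset n → ℤ
  f Z X = ⟪ b , Z ⟫ + (cut′ X Z + ⟪ (λ s → - a′ s) , X ⟫)
  f-≡ : ∀ Z X → f Z X ≡ ⟪ b , Z ⟫ + cut′ X Z - ⟪ a′ , X ⟫
  f-≡ Z X = trans (sym (+-assoc ⟪ b , Z ⟫ (cut′ X Z) _)) (cong (λ z → ⟪ b , Z ⟫ + cut′ X Z + z) (⟪⟫-neg a′ X))
  f-submodular : Submodular (𝟚^ k ⊗ 𝟚^ n) (λ { (Z , X) → f Z X })
  f-submodular = submodular-+ (𝟚^ k ⊗ 𝟚^ n) {f = λ { (Z , X) → ⟪ b , Z ⟫ }} {g = λ { (Z , X) → cut′ X Z + ⟪ (λ s → - a′ s) , X ⟫ }}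
    (λ { (Z , X) (Z′ , X′) → ⟪⟫-submodular b Z Z′ })
    (submodular-+ (𝟚^ k ⊗ 𝟚^ n) {f = λ { (Z , X) → cut′ X Z }} {g = λ { (Z , X) → ⟪ (λ s → - a′ s) , X ⟫ }}
      (λ { (Z , X) (Z′ , X′) → cut-submodular ⟦ E₀ ∘ suc ⟧ᴹ (⟦⟧ᴹ-≥0 (E₀ ∘ suc)) (X , Z) (X′ , Z′) })
      (λ { (Z , X) (Z′ , X′) → ⟪⟫-submodular (λ s → - a′ s) X X′ }))

  B q g : Subset k → ℤ
  B Z = minS (f Z)
  g Z = ⟪ h , ∁ Z ⟫ + - a₀
  -- The bound 0 makes `m` non-negative; `g` asks for at least a₀ - h(∁ Z) inside `Z`.
  q Z = g Z ⊓ 0ℤ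

  h-ma = ⟪⟫∁-modularAntitone h (λ t → ⟦⟧-≥0 (E₀ zero t))

  B-submodular : Submodular (𝟚^ k) B
  B-submodular = minS-submodular (𝟚^ k) (λ { (Z , X) → f Z X }) f-submodular

  q-submodular : Submodular (𝟚^ k) q
  q-submodular Z Z′ = ≤-trans (≤-reflexive (+-comm (q (Z ∩ Z′)) (q (Z ∪ Z′))))
    (submodular-⊓ (dual (𝟚^ k)) {g} 0ℤ g-submodular
      (λ X Y → +-monoˡ-≤ (- a₀) (proj₁ (antitone h-ma X Y))) (λ X Y → +-monoˡ-≤ (- a₀) (proj₂ (antitone h-ma X Y))) Z Z′)
    where
    g-submodular : Submodular (dual (𝟚^ k)) g
    g-submodular X Y = ≤-reflexive (trans (eq ⟪ h , ∁ (X ∩ Y) ⟫ ⟪ h , ∁ (X ∪ Y) ⟫ (- a₀))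
      (trans (cong (λ z → z + (- a₀ + - a₀)) (modular h-ma X Y)) (eq′ ⟪ h , ∁ X ⟫ ⟪ h , ∁ Y ⟫ (- a₀))))
      where
      eq : ∀ x y z → (y + z) + (x + z) ≡ (x + y) + (z + z)
      eq = solve-∀
      eq′ : ∀ x y z → (x + y) + (z + z) ≡ (x + z) + (y + z)
      eq′ = solve-∀

  -- This is `cond` for the row sets that avoid the first row; those containing it give `B+g`.
  B≥0 : ∀ Z → 0ℤ ≤ B Z
  B≥0 Z = minS-glb (f Z) λ X → subst (0ℤ ≤_) (sym (f-≡ Z X))
    (≤-from-gap (gap (cond (false ∷ X) Z)) (eq ⟪ b , Z ⟫ (cut′ X Z) ⟪ a′ , X ⟫))
    where
    eq : ∀ x y z → (x + y - z) - 0ℤ ≡ (x + (0ℤ + y)) - (0ℤ + z)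
    eq = solve-∀

  B+g : ∀ Z → 0ℤ ≤ B Z + g Z
  B+g Z with minS-attained (f Z)
  ... | X , e rewrite e | f-≡ Z X =
    ≤-from-gap (gap (cond (true ∷ X) Z)) (eq ⟪ b , Z ⟫ (cut′ X Z) ⟪ a′ , X ⟫ ⟪ h , ∁ Z ⟫ a₀)
    where
    eq : ∀ x y z w a → (x + y - z + (w + - a)) - 0ℤ ≡ (x + (w + y)) - (a + z)
    eq = solve-∀

  B+q : ∀ Z → 0ℤ ≤ B Z + q Z
  B+q Z with ⊓-sel (g Z) 0ℤ
  ... | inj₁ e rewrite e = B+g Z
  ... | inj₂ e rewrite e | +-identityʳ (B Z) = B≥0 Z

  B⊥ : B ⊥ ≡ 0ℤ
  B⊥ = ≤-antisym (≤-trans (minS-≤ (f ⊥) ⊥) (≤-reflexive f⊥⊥)) (B≥0 ⊥)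
    where
    f⊥⊥ : f ⊥ ⊥ ≡ 0ℤ
    f⊥⊥ rewrite ⟪⟫-⊥ b | ⟪⟫-⊥ (λ s → - a′ s) | ⟪⟫-⊥ (λ s → ⟪ ⟦ E₀ ∘ suc ⟧ᴹ s , ∁ ⊥ ⟫) = refl

  sep = separation B q B-submodular q-submodular B⊥ B+q
  m : Fin k → ℤ
  m = proj₁ sep
  m≤B : ∀ Z → ⟪ m , Z ⟫ ≤ B Z
  m≤B = proj₁ (proj₂ sep)
  -m≤q : ∀ Z → - ⟪ m , Z ⟫ ≤ q Z
  -m≤q = proj₂ (proj₂ sep)

  -- For Z and X full, the upper bound is the total demand minus the supply of the other rows.
  Σm≤a₀ : sum m ≤ a₀
  Σm≤a₀ = ≤-trans (≤-reflexive (sym (⟪⟫-⊤ m))) (≤-trans (m≤B ⊤) (≤-trans (minS-≤ (f ⊤) ⊤) (≤-reflexive e)))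
    where
    eq : ∀ x y → (x + y) + 0ℤ - y ≡ x
    eq = solve-∀
    e : f ⊤ ⊤ ≡ a₀
    e = trans (f-≡ ⊤ ⊤) (trans (cong₂ (λ z w → z + w - ⟪ a′ , ⊤ ⟫) (trans (⟪⟫-⊤ b) (sym Σa≡Σb)) (cut-⊤ ⟦ E₀ ∘ suc ⟧ᴹ ⊤))
          (trans (cong (λ z → sum a + 0ℤ - z) (⟪⟫-⊤ a′)) (eq a₀ (sum a′))))

  a₀≤Σm : a₀ ≤ sum m
  a₀≤Σm = ≤-from-gap (gap (≤-trans (-m≤q ⊤) (i⊓j≤i (g ⊤) 0ℤ)))
    (trans (eq (sum m) a₀) (sym (cong₂ (λ z w → z + - a₀ - - w) (⟪⟫-∁⊤ h) (⟪⟫-⊤ m))))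
    where
    eq : ∀ x y → x - y ≡ 0ℤ + - y - - x
    eq = solve-∀

  Σm≡a₀ : sum m ≡ a₀
  Σm≡a₀ = ≤-antisym Σm≤a₀ a₀≤Σm

  m≥0 : ∀ t → 0ℤ ≤ m t
  m≥0 t = ≤-from-gap (gap (≤-trans (-m≤q ⁅ t ⁆) (i⊓j≤j (g ⁅ t ⁆) 0ℤ)))
    (trans (eq (m t)) (cong (λ z → 0ℤ - - z) (sym (⟪⟫-⁅⁆ m t))))
    where
    eq : ∀ x → x - 0ℤ ≡ 0ℤ - - x
    eq = solve-∀

  m≤h : ∀ t → m t ≤ h t
  -- As `m` has total a₀, the lower bound on the complement of `t` says a₀ - h t ≤ a₀ - m t.
  m≤h t = ≤-from-gap (gap (≤-trans (-m≤q (∁ ⁅ t ⁆)) (i⊓j≤i (g (∁ ⁅ t ⁆)) 0ℤ)))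
    (trans (eq (h t) (m t) a₀) (sym (cong₂ (λ z w → z + - a₀ - - w) (trans (⟪⟫-∁∁ h ⁅ t ⁆) (⟪⟫-⁅⁆ h t))
      (trans (⟪⟫-∁-≡ m ⁅ t ⁆) (cong₂ _-_ Σm≡a₀ (⟪⟫-⁅⁆ m t))))))
    where
    eq : ∀ x y z → x - y ≡ x + - z - - (z - y)
    eq = solve-∀

  row₀ : ∀ t → ∃ λ c → ⟦ c ⟧ ≡ m t × (c ≡ true → E₀ zero t ≡ true)
  row₀ t = as-Bool (m t) (E₀ zero t) (m≥0 t) (m≤h t)

  b′ : Fin k → ℤ
  b′ t = b t - m t

  cond′ : ∀ X Z → ⟪ a′ , X ⟫ ≤ ⟪ b′ , Z ⟫ + cut′ X Z
  cond′ X Z = ≤-from-gap (gap (≤-trans (m≤B Z) (≤-trans (minS-≤ (f Z) X) (≤-reflexive (f-≡ Z X)))))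
    (trans (cong (λ z → z + cut′ X Z - ⟪ a′ , X ⟫) (⟪⟫-- b m Z)) (eq ⟪ b , Z ⟫ ⟪ m , Z ⟫ (cut′ X Z) ⟪ a′ , X ⟫))
    where
    eq : ∀ x y z w → x - y + z - w ≡ x + z - w - y
    eq = solve-∀

  Σ′ : sum a′ ≡ sum b′
  Σ′ = trans (eq a₀ (sum a′)) (trans (cong₂ _-_ Σa≡Σb (sym Σm≡a₀))
         (trans (cong₂ _-_ (sym (⟪⟫-⊤ b)) (sym (⟪⟫-⊤ m))) (trans (sym (⟪⟫-- b m ⊤)) (⟪⟫-⊤ b′))))
    where
    eq : ∀ x y → y ≡ (x + y) - x
    eq = solve-∀

  rec = transport (E₀ ∘ suc) a′ b′ Σ′ cond′

  E : SimpleBigraph (suc n) k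
  E zero    t = proj₁ (row₀ t)
  E (suc s) t = proj₁ rec s t

  E⊑E₀ : E ⊑ E₀
  E⊑E₀ zero    t = proj₂ (proj₂ (row₀ t))
  E⊑E₀ (suc s) t = proj₁ (proj₂ rec) s t

  rows : ∀ s → row E s ≡ a s
  rows zero    = trans (sum-cong-≗ (λ t → proj₁ (proj₂ (row₀ t)))) Σm≡a₀
  rows (suc s) = proj₁ (proj₂ (proj₂ rec)) s

  cols : ∀ t → col E t ≡ b t
  cols t = trans (cong₂ _+_ (proj₁ (proj₂ (row₀ t))) (proj₂ (proj₂ (proj₂ rec)) t)) (eq (m t) (b t))
    where
    eq : ∀ x y → x + (y - x) ≡ y
    eq = solve-∀

term≤sum : {u : Fin n → ℤ} → (∀ i → 0ℤ ≤ u i) → ∀ i → u i ≤ sum u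
term≤sum {u = u} u≥0 i = ≤-trans (≤-reflexive (sym (⟪⟫-⁅⁆ u i)))
  (≤-trans (⟪⟫-monotone u≥0 {⁅ i ⁆} ⊆⊤) (≤-reflexive (⟪⟫-⊤ u)))

sum-combine : ∀ {f g h q : Fin n → ℤ} → (∀ i → f i + g i ≡ h i + q i) → sum f + sum g ≡ sum h + sum q
sum-combine {f = f} {g} {h} {q} e = trans (sym (∑-distrib-+ f g)) (trans (sum-cong-≗ e) (∑-distrib-+ h q))

-- Exchanging edges

δ : Fin n → Fin n → ℤ
δ i j = ⟦ does (j ≟ i) ⟧

δ-refl : ∀ (i : Fin n) → δ i i ≡ 1ℤ
δ-refl zero    = refl
δ-refl (suc i) = δ-refl i

sum-δ : ∀ (i : Fin n) c → sum (λ j → δ i j * c) ≡ c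
sum-δ {suc n} zero    c = trans (cong₂ _+_ (*-identityˡ c) (trans (sum-cong-≗ {n} {λ _ → 0ℤ * c} (λ _ → *-zeroˡ c)) (sum-0 {n}))) (+-identityʳ c)
sum-δ {suc n} (suc i) c = trans (cong (_+ sum (λ j → δ i j * c)) (*-zeroˡ c)) (trans (+-identityˡ _) (sum-δ i c))

put : SimpleBigraph n k → Fin n → Fin k → Bool → SimpleBigraph n k
put M s t b i j = if does (i ≟ s) ∧ does (j ≟ t) then b else M i j

put-view : ∀ (M : SimpleBigraph n k) s t b i j → (i ≡ s × j ≡ t × put M s t b i j ≡ b) ⊎ (put M s t b i j ≡ M i j)
put-view M s t b i j with i ≟ s | j ≟ t
... | yes p | yes q = inj₁ (p , q , refl)
... | yes p | no  q = inj₂ refl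
... | no  p | _     = inj₂ refl

put-here : ∀ (M : SimpleBigraph n k) s t b → put M s t b s t ≡ b
put-here M s t b with s ≟ s | t ≟ t
... | yes p | yes q = refl
... | yes p | no  q = contradiction refl q
... | no  p | _     = contradiction refl p

module _ (M : SimpleBigraph n k) (s : Fin n) (t : Fin k) (b : Bool) {c : ℤ} (change : ⟦ b ⟧ ≡ ⟦ M s t ⟧ + c) where

  ⟦put⟧ : ∀ i j → ⟦ put M s t b i j ⟧ ≡ ⟦ M i j ⟧ + δ s i * (δ t j * c)
  ⟦put⟧ i j with i ≟ s | j ≟ t
  ... | yes refl | yes refl = trans change (cong (λ z → ⟦ M s t ⟧ + z) (sym (trans (*-identityˡ _) (*-identityˡ c))))
  ... | yes refl | no  _    = trans (sym (+-identityʳ _)) (cong (λ z → ⟦ M s j ⟧ + z) (sym (trans (*-identityˡ _) (*-zeroˡ c))))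
  ... | no  _    | q        = trans (sym (+-identityʳ _)) (cong (λ z → ⟦ M i j ⟧ + z) (sym (*-zeroˡ (⟦ does q ⟧ * c))))

  row-put : ∀ i → row (put M s t b) i ≡ row M i + δ s i * c
  row-put i = trans (sum-cong-≗ (λ j → trans (⟦put⟧ i j) (cong (λ z → ⟦ M i j ⟧ + z) (eq (δ s i) (δ t j) c))))
    (trans (∑-distrib-+ (λ j → ⟦ M i j ⟧) (λ j → δ t j * (δ s i * c))) (cong (λ z → row M i + z) (sum-δ t (δ s i * c))))
    where
    eq : ∀ x y z → x * (y * z) ≡ y * (x * z)
    eq = solve-∀

  col-put : ∀ j → col (put M s t b) j ≡ col M j + δ t j * c
  col-put j = trans (sum-cong-≗ (λ i → ⟦put⟧ i j))
    (trans (∑-distrib-+ (λ i → ⟦ M i j ⟧) (λ i → δ s i * (δ t j * c))) (cong (λ z → col M j + z) (sum-δ s (δ t j * c))))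

module _ (M : SimpleBigraph n k) (s : Fin n) (t : Fin k) where

  private
    on : M s t ≡ false → ⟦ true ⟧ ≡ ⟦ M s t ⟧ + 1ℤ
    on e = cong (λ z → ⟦ z ⟧ + 1ℤ) (sym e)
    off : M s t ≡ true → ⟦ false ⟧ ≡ ⟦ M s t ⟧ + - 1ℤ
    off e = cong (λ z → ⟦ z ⟧ + - 1ℤ) (sym e)
    neg : ∀ x y → x + y * - 1ℤ ≡ x - y
    neg = solve-∀

  row-add : M s t ≡ false → ∀ i → row (put M s t true) i ≡ row M i + δ s i
  row-add e i = trans (row-put M s t true (on e) i) (cong (λ z → row M i + z) (*-identityʳ (δ s i)))

  col-add : M s t ≡ false → ∀ j → col (put M s t true) j ≡ col M j + δ t j
  col-add e j = trans (col-put M s t true (on e) j) (cong (λ z → col M j + z) (*-identityʳ (δ t j)))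

  row-del : M s t ≡ true → ∀ i → row (put M s t false) i ≡ row M i - δ s i
  row-del e i = trans (row-put M s t false (off e) i) (neg (row M i) (δ s i))

  col-del : M s t ≡ true → ∀ j → col (put M s t false) j ≡ col M j - δ t j
  col-del e j = trans (col-put M s t false (off e) j) (neg (col M j) (δ t j))

1+i≰i : ∀ i → ¬ 1ℤ + i ≤ i
1+i≰i i h = case ≤-from-gap {1ℤ} {0ℤ} (gap h) (eq i) of λ { (+≤+ ()) }
  where
  eq : ∀ x → 0ℤ - 1ℤ ≡ x - (1ℤ + x)
  eq = solve-∀

1+-cancel-≤ : ∀ i j → 1ℤ + i ≤ 1ℤ + j → i ≤ j
1+-cancel-≤ i j h = ≤-from-gap (gap h) (eq i j)
  where
  eq : ∀ x y → y - x ≡ 1ℤ + y - (1ℤ + x)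
  eq = solve-∀

exists-excess : ∀ (f g : Fin n → Bool) → 1ℤ + sum (λ i → ⟦ f i ⟧) ≤ sum (λ i → ⟦ g i ⟧) → ∃ λ i → f i ≡ false × g i ≡ true
exists-excess {n} f g h with any? (λ i → (f i Bool.≟ false) ×-dec (g i Bool.≟ true))
... | yes p = p
... | no ¬p = contradiction (≤-trans h (sum-mono g≤f)) (1+i≰i (sum (λ i → ⟦ f i ⟧)))
  where
  g≤f : ∀ i → ⟦ g i ⟧ ≤ ⟦ f i ⟧
  g≤f i with f i in ef | g i in eg
  ... | true  | true  = ≤-refl
  ... | true  | false = ⟦⟧-≥0 true
  ... | false | true  = contradiction (i , ef , eg) ¬p
  ... | false | false = ≤-refl

-- Hamming distance and alternating walks

dist : SimpleBigraph n k → SimpleBigraph n k → ℤ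
dist A B = sum (λ s → sum (λ t → ⟦ A s t xor B s t ⟧))

dist-≥ : ∀ (A B : SimpleBigraph n k) s t → ⟦ A s t xor B s t ⟧ ≤ dist A B
dist-≥ A B s t = ≤-trans (term≤sum (λ t → ⟦⟧-≥0 (A s t xor B s t)) t)
  (term≤sum {u = λ s → sum (λ t → ⟦ A s t xor B s t ⟧)} (λ s → sum-≥0 (λ t → ⟦⟧-≥0 (A s t xor B s t))) s)

dist-≥0 : ∀ (A B : SimpleBigraph n k) → 0ℤ ≤ dist A B
dist-≥0 A B = sum-≥0 (λ s → sum-≥0 (λ t → ⟦⟧-≥0 (A s t xor B s t)))

dist-mono : ∀ (A B C D : SimpleBigraph n k) → (∀ s t → ⟦ A s t xor B s t ⟧ ≤ ⟦ C s t xor D s t ⟧) → dist A B ≤ dist C D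
dist-mono A B C D h = sum-mono (λ s → sum-mono (h s))

Between : SimpleBigraph n k → SimpleBigraph n k → SimpleBigraph n k → Set
Between A Q B = ∀ s t → Q s t ≡ A s t ⊎ Q s t ≡ B s t

dist-between : ∀ {A Q B : SimpleBigraph n k} → Between A Q B → dist A B ≡ dist A Q + dist Q B
dist-between {A = A} {Q} {B} btw =
  trans (sum-cong-≗ (λ s → trans (sum-cong-≗ (pt s)) (∑-distrib-+ (λ t → ⟦ A s t xor Q s t ⟧) (λ t → ⟦ Q s t xor B s t ⟧))))
        (∑-distrib-+ (λ s → sum (λ t → ⟦ A s t xor Q s t ⟧)) (λ s → sum (λ t → ⟦ Q s t xor B s t ⟧)))
  where
  self : ∀ a → ⟦ a xor a ⟧ ≡ 0ℤ
  self true  = refl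
  self false = refl
  pt : ∀ s t → ⟦ A s t xor B s t ⟧ ≡ ⟦ A s t xor Q s t ⟧ + ⟦ Q s t xor B s t ⟧
  pt s t with btw s t
  ... | inj₁ e rewrite e | self (A s t) = sym (+-identityˡ _)
  ... | inj₂ e rewrite e | self (B s t) = sym (+-identityʳ _)

-- Only the effect of the walk is kept: switching along it preserves all degrees except at its ends
-- `t` and `s`.
Walk : (A B : SimpleBigraph n k) → Fin k → Set
Walk A B t = ∃₂ λ s Q → Between A Q B × 1ℤ + row B s ≤ row A s ×
               (∀ i → row Q i ≡ row A i - δ s i) × (∀ j → col Q j ≡ col A j - δ t j)

-- An alternating walk from t in the symmetric difference, T → S along A − B and S → T along B − A; it stops at the
-- first s where A has more edges than B.  A is switched during the walk and ends as Q.
walk : ∀ fuel (A B : SimpleBigraph n k) t → dist A B ≤ + fuel → (∀ j → col B j + δ t j ≤ col A j) → Walk A B t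
walk fuel A B t d≤ B+δ≤A with exists-excess (λ s → B s t) (λ s → A s t)
  (subst (_≤ col A t) (trans (cong (λ z → col B t + z) (δ-refl t)) (+-comm (col B t) 1ℤ)) (B+δ≤A t))
... | s₁ , Bs₁t , As₁t with (1ℤ + row B s₁) ≤? row A s₁
...   | yes h = s₁ , put A s₁ t false , btw , h , row-del A s₁ t As₁t , col-del A s₁ t As₁t
  where
  btw : Between A (put A s₁ t false) B
  btw i j with put-view A s₁ t false i j
  ... | inj₁ (refl , refl , e) = inj₂ (trans e (sym Bs₁t))
  ... | inj₂ e = inj₁ e
-- Having lost the edge s₁t, row `s₁` of `A` is strictly smaller than that of `B`, so the walk can
-- leave `s₁` along B - A.
...   | no ¬h with exists-excess (put A s₁ t false s₁) (B s₁) (≤-trans (≤-reflexive 1+rA₁≡) rA≤rB)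
  where
  1+rA₁≡ : 1ℤ + row (put A s₁ t false) s₁ ≡ row A s₁
  1+rA₁≡ = trans (cong (λ z → 1ℤ + z) (trans (row-del A s₁ t As₁t s₁) (cong (λ z → row A s₁ - z) (δ-refl s₁)))) (eq (row A s₁))
    where
    eq : ∀ x → 1ℤ + (x - 1ℤ) ≡ x
    eq = solve-∀
  rA≤rB : row A s₁ ≤ row B s₁
  rA≤rB = 1+-cancel-≤ (row A s₁) (row B s₁) (i<j⇒suc[i]≤j (≰⇒> ¬h))
...     | t₁ , A₁s₁t₁ , Bs₁t₁ = again fuel d≤
  where
  A₁ A₂ : SimpleBigraph _ _
  A₁ = put A s₁ t false
  A₂ = put A₁ s₁ t₁ true
  btw₂ : Between A A₂ B
  btw₂ i j with put-view A₁ s₁ t₁ true i j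
  ... | inj₁ (refl , refl , e) = inj₂ (trans e (sym Bs₁t₁))
  ... | inj₂ e with put-view A s₁ t false i j
  ...   | inj₁ (refl , refl , e′) = inj₂ (trans e (trans e′ (sym Bs₁t)))
  ...   | inj₂ e′ = inj₁ (trans e e′)
  A₂s₁t : A₂ s₁ t ≡ false
  A₂s₁t with put-view A₁ s₁ t₁ true s₁ t
  ... | inj₁ (_ , refl , _) = contradiction (trans (sym Bs₁t₁) Bs₁t) (λ ())
  ... | inj₂ e = trans e (put-here A s₁ t false)
  rowA₂ : ∀ i → row A₂ i ≡ row A i
  rowA₂ i = trans (row-add A₁ s₁ t₁ A₁s₁t₁ i) (trans (cong (_+ δ s₁ i) (row-del A s₁ t As₁t i)) (eq (row A i) (δ s₁ i)))
    where
    eq : ∀ x y → x - y + y ≡ x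
    eq = solve-∀
  colA₂ : ∀ j → col A₂ j ≡ col A j - δ t j + δ t₁ j
  colA₂ j = trans (col-add A₁ s₁ t₁ A₁s₁t₁ j) (cong (_+ δ t₁ j) (col-del A s₁ t As₁t j))
  dist₂ : 1ℤ + dist A₂ B ≤ dist A B
  dist₂ = subst (1ℤ + dist A₂ B ≤_) (sym (dist-between btw₂)) (+-monoˡ-≤ (dist A₂ B)
    (subst (λ z → ⟦ z ⟧ ≤ dist A A₂) (cong₂ _xor_ As₁t A₂s₁t) (dist-≥ A A₂ s₁ t)))
  -- The unit of excess has moved from column `t` to column `t₁`, so the hypothesis of the walk
  -- holds again.
  B+δ≤A₂ : ∀ j → col B j + δ t₁ j ≤ col A₂ j
  B+δ≤A₂ j = ≤-from-gap (gap (B+δ≤A j)) (trans (cong (_- (col B j + δ t₁ j)) (colA₂ j)) (eq (col A j) (col B j) (δ t j) (δ t₁ j)))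
    where
    eq : ∀ a b x y → (a - x + y) - (b + y) ≡ a - (b + x)
    eq = solve-∀
  again : ∀ fuel → dist A B ≤ + fuel → Walk A B t
  again zero    d≤ = contradiction (≤-trans (+-monoʳ-≤ 1ℤ (dist-≥0 A₂ B)) (≤-trans dist₂ d≤)) λ { (+≤+ ()) }
  again (suc f) d≤ with walk f A₂ B t₁ (1+-cancel-≤ (dist A₂ B) (+ f) (≤-trans dist₂ d≤)) B+δ≤A₂
  ... | s , Q , btw , h , rQ , cQ = s , Q , btwQ , ≤-trans h (≤-reflexive (rowA₂ s)) ,
          (λ i → trans (rQ i) (cong (_- δ s i) (rowA₂ i))) ,
          (λ j → trans (cQ j) (trans (cong (_- δ t₁ j) (colA₂ j)) (eq (col A j) (δ t j) (δ t₁ j))))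
    where
    eq : ∀ a x y → (a - x + y) - y ≡ a - x
    eq = solve-∀
    btwQ : Between A Q B
    btwQ i j with btw i j
    ... | inj₂ e = inj₂ e
    ... | inj₁ e with btw₂ i j
    ...   | inj₁ e′ = inj₁ (trans e e′)
    ...   | inj₂ e′ = inj₂ (trans e e′)

between-⊑ : ∀ {A Q B C : SimpleBigraph n k} → Between A Q B → A ⊑ C → B ⊑ C → Q ⊑ C
between-⊑ btw A⊑C B⊑C s t e with btw s t
... | inj₁ e′ = A⊑C s t (trans (sym e′) e)
... | inj₂ e′ = B⊑C s t (trans (sym e′) e)

+δ-≤ : ∀ {f g : Fin n → ℤ} → (∀ i → f i ≤ g i) → ∀ s → 1ℤ + f s ≤ g s → ∀ i → f i + δ s i ≤ g i
+δ-≤ {f = f} f≤g s h i with i ≟ s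
... | yes refl = ≤-trans (≤-reflexive (+-comm (f s) 1ℤ)) h
... | no  _    = ≤-trans (≤-reflexive (+-identityʳ (f i))) (f≤g i)

-- Where Q takes the entry of A the partner takes that of B, and vice versa.
partner : (A Q B : SimpleBigraph n k) → SimpleBigraph n k
partner A Q B s t = (A s t xor B s t) xor Q s t

module _ {A Q B : SimpleBigraph n k} (btw : Between A Q B) where

  private
    xor-self : ∀ a b → (a xor b) xor a ≡ b
    xor-self true  true  = refl
    xor-self true  false = refl
    xor-self false true  = refl
    xor-self false false = refl
    xor-other : ∀ a b → (a xor b) xor b ≡ a
    xor-other true  true  = refl
    xor-other true  false = refl
    xor-other false true  = refl
    xor-other false false = refl

  partner-view : ∀ s t → (Q s t ≡ A s t × partner A Q B s t ≡ B s t) ⊎ (Q s t ≡ B s t × partner A Q B s t ≡ A s t)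
  partner-view s t with btw s t
  ... | inj₁ e = inj₁ (e , trans (cong (λ z → (A s t xor B s t) xor z) e) (xor-self (A s t) (B s t)))
  ... | inj₂ e = inj₂ (e , trans (cong (λ z → (A s t xor B s t) xor z) e) (xor-other (A s t) (B s t)))

  partner-between : Between A (partner A Q B) B
  partner-between s t with partner-view s t
  ... | inj₁ (_ , e) = inj₂ e
  ... | inj₂ (_ , e) = inj₁ e

  partner-common : ∀ s t → A s t ≡ true → B s t ≡ true → partner A Q B s t ≡ true
  partner-common s t a b with partner-view s t
  ... | inj₁ (_ , e) = trans e b
  ... | inj₂ (_ , e) = trans e a

  private
    ⟦partner⟧ : ∀ s t → ⟦ Q s t ⟧ + ⟦ partner A Q B s t ⟧ ≡ ⟦ A s t ⟧ + ⟦ B s t ⟧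
    ⟦partner⟧ s t with partner-view s t
    ... | inj₁ (e , e′) = cong₂ (λ x y → ⟦ x ⟧ + ⟦ y ⟧) e e′
    ... | inj₂ (e , e′) = trans (cong₂ (λ x y → ⟦ x ⟧ + ⟦ y ⟧) e e′) (+-comm ⟦ B s t ⟧ ⟦ A s t ⟧)

  row-partner : ∀ {s} → (∀ i → row Q i ≡ row A i - δ s i) → ∀ i → row (partner A Q B) i ≡ row B i + δ s i
  row-partner {s} rQ i = trans (eq₁ (row Q i) _) (trans (cong₂ _-_ (sum-combine (⟦partner⟧ i)) (rQ i)) (eq₂ (row A i) (row B i) (δ s i)))
    where
    eq₁ : ∀ x y → y ≡ (x + y) - x
    eq₁ = solve-∀
    eq₂ : ∀ a b d → (a + b) - (a - d) ≡ b + d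
    eq₂ = solve-∀

  col-partner : ∀ {t} → (∀ j → col Q j ≡ col A j - δ t j) → ∀ j → col (partner A Q B) j ≡ col B j + δ t j
  col-partner {t} cQ j = trans (eq₁ (col Q j) _) (trans (cong₂ _-_ (sum-combine (λ i → ⟦partner⟧ i j)) (cQ j)) (eq₂ (col A j) (col B j) (δ t j)))
    where
    eq₁ : ∀ x y → y ≡ (x + y) - x
    eq₁ = solve-∀
    eq₂ : ∀ a b d → (a + b) - (a - d) ≡ b + d
    eq₂ = solve-∀

  dist-partner : dist A (partner A Q B) ≤ dist Q B
  dist-partner = dist-mono A (partner A Q B) Q B pt
    where
    self : ∀ a b → ⟦ a xor a ⟧ ≤ ⟦ b xor b ⟧
    self true  true  = ≤-refl
    self true  false = ≤-refl
    self false true  = ≤-refl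
    self false false = ≤-refl
    pt : ∀ s t → ⟦ A s t xor partner A Q B s t ⟧ ≤ ⟦ Q s t xor B s t ⟧
    pt s t with partner-view s t
    ... | inj₁ (e , e′) = ≤-reflexive (cong₂ (λ x y → ⟦ x xor y ⟧) (sym e) e′)
    ... | inj₂ (e , e′) = subst (_≤ ⟦ Q s t xor B s t ⟧) (cong (λ y → ⟦ A s t xor y ⟧) (sym e′))
                            (≤-trans (self (A s t) (B s t)) (≤-reflexive (cong (λ y → ⟦ y xor B s t ⟧) (sym e))))

-- Trading units of flow for edges

module _ (E₀ : SimpleBigraph n k) where

  -- Lying in both `E` and `B` keeps these edges off the flow, so switching along a flow path never
  -- removes them from `E`.
  Settled : (E B F : SimpleBigraph n k) → Set
  Settled E B F = ∀ s t → F s t ≡ true → E₀ s t ≡ true → E s t ≡ true × B s t ≡ true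

  -- The columns of `F*` have to reach ν, hence the equality; the rows have to stay below the rank,
  -- hence the upper bound.
  Realization : (E B F : SimpleBigraph n k) → Set
  Realization E B F = ∃₂ λ E* F* → E* ⊑ E₀ × (∀ s → row E* s ≡ row E s) × (∀ t → col E* t ≡ col E t) ×
    (∀ s t → F* s t ≡ true → E₀ s t ≡ true → E* s t ≡ true) ×
    (∀ t → col F* t ≡ col F t + (col E t - col B t)) × (∀ s → row F* s ≤ row F s + (row E s - row B s))

  -- `dist E B` is the size of the flow, and every trade lowers it. The last hypothesis comes from
  -- the rank of single vertices and guarantees that an edge about to join `F` is not there yet.
  realize : ∀ fuel (E B F : SimpleBigraph n k) → dist E B ≤ + fuel → E ⊑ E₀ → B ⊑ E₀ → Settled E B F →
            (∀ s → row B s ≤ row E s) → (∀ t → col B t ≤ col E t) →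
            (∀ s → row F s + (row E s - row B s) ≤ 1ℤ) → Realization E B F
  realize fuel E B F d≤ E⊑E₀ B⊑E₀ settled rB≤rE cB≤cE ≤1 with any? (λ t → (1ℤ + col B t) ≤? col E t)
  ... | no ¬p = E , F , E⊑E₀ , (λ _ → refl) , (λ _ → refl) , (λ s t f e → proj₁ (settled s t f e)) ,
          (λ t → trans (sym (+-identityʳ (col F t))) (cong (λ z → col F t + z) (sym (i≡j⇒i-j≡0 (cE≡cB t))))) ,
          (λ s → ≤-trans (≤-reflexive (sym (+-identityʳ (row F s)))) (+-monoʳ-≤ (row F s) (gap (rB≤rE s))))
    where
    cE≡cB : ∀ t → col E t ≡ col B t
    cE≡cB t = ≤-antisym (1+-cancel-≤ (col E t) (col B t) (i<j⇒suc[i]≤j (≰⇒> (λ h → ¬p (t , h))))) (cB≤cE t)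
  ... | yes (t , t-excess) = go
    where
    -- Without the arcs entering t, so that the walk never uses the pair that closes it.
    B° : SimpleBigraph n k
    B° i j = B i j ∧ (E i j ∨ not (does (j ≟ t)))
    btw° : Between E B° B
    btw° i j with B i j | E i j | does (j ≟ t)
    ... | false | _     | _     = inj₂ refl
    ... | true  | true  | _     = inj₂ refl
    ... | true  | false | true  = inj₁ refl
    ... | true  | false | false = inj₂ refl
    colB°≤ : ∀ j → col B° j ≤ col B j
    colB°≤ j = sum-mono pt
      where
      ∧-≤ : ∀ b c → ⟦ b ∧ c ⟧ ≤ ⟦ b ⟧
      ∧-≤ true  true  = ≤-refl
      ∧-≤ true  false = ⟦⟧-≥0 true
      ∧-≤ false _     = ≤-refl
      pt : ∀ i → ⟦ B° i j ⟧ ≤ ⟦ B i j ⟧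
      pt i = ∧-≤ (B i j) _
    cB+δ≤cE : ∀ j → col B j + δ t j ≤ col E j
    cB+δ≤cE = +δ-≤ cB≤cE t t-excess

    -- A trade preserves the degrees of `E` and changes those of `F` and `B` by the same amount, so
    -- the degrees promised for `F*` stay the same.
    continue : ∀ E′ B′ F′ → 1ℤ + dist E′ B′ ≤ dist E B → E′ ⊑ E₀ → B′ ⊑ E₀ → Settled E′ B′ F′ →
               (∀ s → row E′ s ≡ row E s) → (∀ t → col E′ t ≡ col E t) →
               (∀ s → row B′ s ≤ row E s) → (∀ t → col B′ t ≤ col E t) →
               (∀ s → row F′ s - row B′ s ≡ row F s - row B s) → (∀ t → col F′ t - col B′ t ≡ col F t - col B t) →
               Realization E B F
    continue E′ B′ F′ closer E′⊑ B′⊑ settled′ rE′ cE′ rB′ cB′ rF′ cF′ = descend fuel (≤-trans closer d≤)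
      where
      eq : ∀ f e b → f + (e - b) ≡ (f - b) + e
      eq = solve-∀
      rows≡ : ∀ s → row F′ s + (row E′ s - row B′ s) ≡ row F s + (row E s - row B s)
      rows≡ s = trans (eq (row F′ s) (row E′ s) (row B′ s)) (trans (cong₂ _+_ (rF′ s) (rE′ s)) (sym (eq (row F s) (row E s) (row B s))))
      cols≡ : ∀ t → col F′ t + (col E′ t - col B′ t) ≡ col F t + (col E t - col B t)
      cols≡ t = trans (eq (col F′ t) (col E′ t) (col B′ t)) (trans (cong₂ _+_ (cF′ t) (cE′ t)) (sym (eq (col F t) (col E t) (col B t))))
      descend : ∀ fuel → 1ℤ + dist E′ B′ ≤ + fuel → Realization E B F
      descend zero    h = contradiction (≤-trans (+-monoʳ-≤ 1ℤ (dist-≥0 E′ B′)) h) λ { (+≤+ ()) }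
      descend (suc f) h with realize f E′ B′ F′ (1+-cancel-≤ (dist E′ B′) (+ f) h) E′⊑ B′⊑ settled′
                               (λ s → ≤-trans (rB′ s) (≤-reflexive (sym (rE′ s)))) (λ t → ≤-trans (cB′ t) (≤-reflexive (sym (cE′ t))))
                               (λ s → ≤-trans (≤-reflexive (rows≡ s)) (≤1 s))
      ... | E* , F* , sub , rE* , cE* , F⊆ , cF* , rF* =
            E* , F* , sub , (λ s → trans (rE* s) (rE′ s)) , (λ t → trans (cE* t) (cE′ t)) , F⊆ ,
            (λ t → trans (cF* t) (cols≡ t)) , (λ s → ≤-trans (rF* s) (≤-reflexive (rows≡ s)))

    module Closing (s : Fin n) (Q : SimpleBigraph n k) (btwQ : Between E Q B°) (s-excess° : 1ℤ + row B° s ≤ row E s)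
                   (rowQ : ∀ i → row Q i ≡ row E i - δ s i) (colQ : ∀ j → col Q j ≡ col E j - δ t j) where

      btw : Between E Q B
      btw i j with btwQ i j
      ... | inj₁ e = inj₁ e
      ... | inj₂ e with btw° i j
      ...   | inj₁ e′ = inj₁ (trans e e′)
      ...   | inj₂ e′ = inj₂ (trans e e′)

      -- The flow E - B₁ equals Q - B: the path is dropped while `E` stays untouched.
      B₁ : SimpleBigraph n k
      B₁ = partner E Q B

      -- `Q` has one edge fewer than `E` in column `t`, so some entry there has already been
      -- switched.
      Q-closer : 1ℤ + dist Q B ≤ dist E B
      Q-closer with exists-excess (λ i → Q i t) (λ i → E i t) (≤-reflexive (trans (cong (λ z → 1ℤ + z) (trans (colQ t) (cong (λ z → col E t - z) (δ-refl t)))) (eq (col E t))))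
        where
        eq : ∀ x → 1ℤ + (x - 1ℤ) ≡ x
        eq = solve-∀
      ... | i , q , e = subst (1ℤ + dist Q B ≤_) (sym (dist-between btw)) (+-monoˡ-≤ (dist Q B)
              (subst (λ z → ⟦ z ⟧ ≤ dist E Q) (cong₂ _xor_ e q) (dist-≥ E Q i t)))

      B₁-closer : 1ℤ + dist E B₁ ≤ dist E B
      B₁-closer = ≤-trans (+-monoʳ-≤ 1ℤ (dist-partner btw)) Q-closer

      rowB₁ : ∀ i → row B₁ i ≡ row B i + δ s i
      rowB₁ = row-partner btw rowQ
      colB₁ : ∀ j → col B₁ j ≡ col B j + δ t j
      colB₁ = col-partner btw colQ
      B₁⊑E₀ : B₁ ⊑ E₀
      B₁⊑E₀ = between-⊑ (partner-between btw) E⊑E₀ B⊑E₀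

      -- The arc from `s` to `t` closes the path to a cycle of the flow; dropping a cycle leaves the
      -- degrees of `B` alone, and `F` gains nothing.
      cancel : E s t ≡ false → B s t ≡ true → Realization E B F
      cancel Est Bst = continue E B′ F closer E⊑E₀ B′⊑ settled′ (λ _ → refl) (λ _ → refl)
          (λ i → ≤-trans (≤-reflexive (rowB′ i)) (rB≤rE i)) (λ j → ≤-trans (≤-reflexive (colB′ j)) (cB≤cE j))
          (λ i → cong (λ z → row F i - z) (rowB′ i)) (λ j → cong (λ z → col F j - z) (colB′ j))
        where
        B′ : SimpleBigraph n k
        B′ = put B₁ s t false
        B°st : B° s t ≡ false
        B°st with t ≟ t
        ... | yes _ rewrite Est | Bst = refl
        ... | no ¬p = contradiction refl ¬p
        Qst : Q s t ≡ false
        Qst with btwQ s t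
        ... | inj₁ e = trans e Est
        ... | inj₂ e = trans e B°st
        B₁st : B₁ s t ≡ true
        B₁st rewrite Est | Bst | Qst = refl
        eq : ∀ x d → x + d - d ≡ x
        eq = solve-∀
        rowB′ : ∀ i → row B′ i ≡ row B i
        rowB′ i = trans (row-del B₁ s t B₁st i) (trans (cong (_- δ s i) (rowB₁ i)) (eq (row B i) (δ s i)))
        colB′ : ∀ j → col B′ j ≡ col B j
        colB′ j = trans (col-del B₁ s t B₁st j) (trans (cong (_- δ t j) (colB₁ j)) (eq (col B j) (δ t j)))
        btw′ : Between E B′ B₁
        btw′ i j with put-view B₁ s t false i j
        ... | inj₁ (refl , refl , e) = inj₁ (trans e (sym Est))
        ... | inj₂ e = inj₂ e
        closer : 1ℤ + dist E B′ ≤ dist E B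
        closer = ≤-trans (+-monoʳ-≤ 1ℤ (≤-trans (i≤i+j (dist E B′) (dist B′ B₁) {{ℤ.nonNegative (dist-≥0 B′ B₁)}}) (≤-reflexive (sym (dist-between btw′))))) B₁-closer
        B′⊑ : B′ ⊑ E₀
        B′⊑ = between-⊑ btw′ E⊑E₀ B₁⊑E₀
        settled′ : Settled E B′ F
        settled′ i j f e with settled i j f e | put-view B₁ s t false i j
        ... | Eij , Bij | inj₁ (refl , refl , _) = contradiction (trans (sym Eij) Est) (λ ())
        ... | Eij , Bij | inj₂ e′ = Eij , trans e′ (partner-common btw i j Eij Bij)

      module _ (not-into : ¬ (E s t ≡ false × B s t ≡ true)) where

        -- In row `s` the two graphs can differ only at `t`, and only if the flow has the arc from
        -- `s` to `t`. With that excluded, the excess found at `s` for `B°` is one for `B`.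
        B°s≡Bs : ∀ j → B° s j ≡ B s j
        B°s≡Bs j with j ≟ t
        B°s≡Bs j | no _ with B s j | E s j
        ... | true  | true  = refl
        ... | true  | false = refl
        ... | false | _     = refl
        B°s≡Bs j | yes refl with B s t | E s t
        ... | true  | true  = refl
        ... | true  | false = contradiction (refl , refl) not-into
        ... | false | _     = refl

        s-excess : 1ℤ + row B s ≤ row E s
        s-excess = subst (λ z → 1ℤ + z ≤ row E s) (sum-cong-≗ (λ j → cong ⟦_⟧ (B°s≡Bs j))) s-excess°

        -- An edge of `F` at `s` and the excess at `s` would together exceed the bound `≤1`.
        Fst : F s t ≡ false
        Fst with F s t in f
        ... | false = refl
        ... | true  = contradiction (≤-trans (≤-from-gap (gap s-excess ⊹ gap (term≤sum (λ j → ⟦⟧-≥0 (F s j)) t)) e) (≤1 s)) λ { (+≤+ (ℕ.s≤s ())) }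
          where
          eq : ∀ f e b → (f + (e - b)) - + 2 ≡ (e - (1ℤ + b)) + (f - 1ℤ)
          eq = solve-∀
          e : (row F s + (row E s - row B s)) - + 2 ≡ (row E s - (1ℤ + row B s)) + (row F s - ⟦ F s t ⟧)
          e rewrite f = eq (row F s) (row E s) (row B s)

        settle : ∀ E′ B′ → 1ℤ + dist E′ B′ ≤ dist E B → E′ ⊑ E₀ → B′ ⊑ E₀ → Settled E′ B′ (put F s t true) →
                 (∀ i → row E′ i ≡ row E i) → (∀ j → col E′ j ≡ col E j) →
                 (∀ i → row B′ i ≡ row B i + δ s i) → (∀ j → col B′ j ≡ col B j + δ t j) → Realization E B F
        settle E′ B′ closer E′⊑ B′⊑ settled′ rE′ cE′ rB′ cB′ =
          continue E′ B′ (put F s t true) closer E′⊑ B′⊑ settled′ rE′ cE′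
            (λ i → ≤-trans (≤-reflexive (rB′ i)) (+δ-≤ rB≤rE s s-excess i)) (λ j → ≤-trans (≤-reflexive (cB′ j)) (cB+δ≤cE j))
            (λ i → trans (cong₂ _-_ (row-add F s t Fst i) (rB′ i)) (eq (row F i) (row B i) (δ s i)))
            (λ j → trans (cong₂ _-_ (col-add F s t Fst j) (cB′ j)) (eq (col F j) (col B j) (δ t j)))
          where
          eq : ∀ f b d → (f + d) - (b + d) ≡ f - b
          eq = solve-∀

        -- Serves `st` common to `E` and `B` as well as `st` outside `E₀`: `F` may take the edge
        -- while `E` stays as it is.
        settle-unused : (E₀ s t ≡ true → E s t ≡ true × B s t ≡ true) → Realization E B F
        settle-unused st-ok = settle E B₁ B₁-closer E⊑E₀ B₁⊑E₀ settled′ (λ _ → refl) (λ _ → refl) rowB₁ colB₁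
          where
          settled′ : Settled E B₁ (put F s t true)
          settled′ i j f e with put-view F s t true i j
          ... | inj₁ (refl , refl , _) = let a , b = st-ok e in a , partner-common btw s t a b
          ... | inj₂ e′ = let a , b = settled i j (trans (sym e′) f) e in a , partner-common btw i j a b

        -- Here `st` is itself an arc of the flow from `t` to `s`; this single arc is traded in
        -- place of the path.
        settle-used : E s t ≡ true → B s t ≡ false → Realization E B F
        settle-used Est Bst = settle E B′ closer E⊑E₀ (between-⊑ btw′ E⊑E₀ B⊑E₀) settled′ (λ _ → refl) (λ _ → refl)
                                (row-add B s t Bst) (col-add B s t Bst)
          where
          B′ : SimpleBigraph n k
          B′ = put B s t true
          btw′ : Between E B′ B
          btw′ i j with put-view B s t true i j
          ... | inj₁ (refl , refl , e) = inj₁ (trans e (sym Est))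
          ... | inj₂ e = inj₂ e
          closer : 1ℤ + dist E B′ ≤ dist E B
          closer = subst (1ℤ + dist E B′ ≤_) (trans (+-comm (dist B′ B) (dist E B′)) (sym (dist-between btw′))) (+-monoˡ-≤ (dist E B′)
            (subst (λ z → ⟦ z ⟧ ≤ dist B′ B) (cong₂ _xor_ (put-here B s t true) Bst) (dist-≥ B′ B s t)))
          settled′ : Settled E B′ (put F s t true)
          settled′ i j f e with put-view F s t true i j | put-view B s t true i j
          ... | inj₁ (refl , refl , _) | _ = Est , put-here B s t true
          ... | inj₂ e′ | inj₁ (_ , _ , e″) = proj₁ (settled i j (trans (sym e′) f) e) , e″
          ... | inj₂ e′ | inj₂ e″ = let a , b = settled i j (trans (sym e′) f) e in a , trans e″ b

        -- `Q` lacks one edge at `s` and one at `t`, and `st` restores both degrees. Put into `B` as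
        -- well, the new edge carries no flow, which becomes Q - B.
        settle-new : E s t ≡ false → B s t ≡ false → E₀ s t ≡ true → Realization E B F
        settle-new Est Bst E₀st = settle E′ B′ closer E′⊑ B′⊑ settled′ rowE′ colE′ (row-add B s t Bst) (col-add B s t Bst)
          where
          E′ B′ : SimpleBigraph n k
          E′ = put Q s t true
          B′ = put B s t true
          Qst : Q s t ≡ false
          Qst with btw s t
          ... | inj₁ e = trans e Est
          ... | inj₂ e = trans e Bst
          eq : ∀ x d → x - d + d ≡ x
          eq = solve-∀
          rowE′ : ∀ i → row E′ i ≡ row E i
          rowE′ i = trans (row-add Q s t Qst i) (trans (cong (_+ δ s i) (rowQ i)) (eq (row E i) (δ s i)))
          colE′ : ∀ j → col E′ j ≡ col E j
          colE′ j = trans (col-add Q s t Qst j) (trans (cong (_+ δ t j) (colQ j)) (eq (col E j) (δ t j)))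
          put-⊑ : ∀ {M} → M ⊑ E₀ → put M s t true ⊑ E₀
          put-⊑ {M} M⊑ i j e with put-view M s t true i j
          ... | inj₁ (refl , refl , _) = E₀st
          ... | inj₂ e′ = M⊑ i j (trans (sym e′) e)
          E′⊑ : E′ ⊑ E₀
          E′⊑ = put-⊑ (between-⊑ btw E⊑E₀ B⊑E₀)
          B′⊑ : B′ ⊑ E₀
          B′⊑ = put-⊑ B⊑E₀
          closer : 1ℤ + dist E′ B′ ≤ dist E B
          closer = ≤-trans (+-monoʳ-≤ 1ℤ (dist-mono E′ B′ Q B pt)) Q-closer
            where
            pt : ∀ i j → ⟦ E′ i j xor B′ i j ⟧ ≤ ⟦ Q i j xor B i j ⟧
            pt i j with does (i ≟ s) ∧ does (j ≟ t)
            ... | true  = ⟦⟧-≥0 (Q i j xor B i j)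
            ... | false = ≤-refl
          settled′ : Settled E′ B′ (put F s t true)
          settled′ i j f e with does (i ≟ s) ∧ does (j ≟ t)
          ... | true  = refl , refl
          ... | false with settled i j f e | btw i j
          ...   | a , b | inj₁ q = trans q a , b
          ...   | a , b | inj₂ q = trans q b , b

      close : Realization E B F
      close with E s t in Est | B s t in Bst
      ... | false | true  = cancel Est Bst
      ... | true  | true  = settle-unused (λ { (e , _) → contradiction (trans (sym Est) e) λ () }) (λ _ → Est , Bst)
      ... | true  | false = settle-used (λ { (e , _) → contradiction (trans (sym Est) e) λ () }) Est Bst
      ... | false | false with E₀ s t in E₀st
      ...   | true  = settle-new (λ { (_ , b) → contradiction (trans (sym Bst) b) λ () }) Est Bst E₀st
      ...   | false = settle-unused (λ { (_ , b) → contradiction (trans (sym Bst) b) λ () }) (λ e → contradiction (trans (sym E₀st) e) λ ())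

    go : Realization E B F
    go with walk fuel E B° t
              (≤-trans (≤-trans (i≤i+j (dist E B°) (dist B° B) {{ℤ.nonNegative (dist-≥0 B° B)}}) (≤-reflexive (sym (dist-between btw°)))) d≤)
              (λ j → ≤-trans (+-monoˡ-≤ (δ t j) (colB°≤ j)) (cB+δ≤cE j))
    ... | s , Q , btwQ , h , rQ , cQ = Closing.close s Q btwQ h rQ cQ

-- Counting and rank

⟪⟫-comm : ∀ (M : Fin n → Fin k → ℤ) X Y → ⟪ (λ s → ⟪ M s , Y ⟫) , X ⟫ ≡ ⟪ (λ t → ⟪ (λ s → M s t) , X ⟫) , Y ⟫
⟪⟫-comm {n} {k} M X Y = begin
  ⟪ (λ s → ⟪ M s , Y ⟫) , X ⟫      ≡⟨ sum-cong-≗ (λ s → if-sum (lookup X s) (λ t → if lookup Y t then M s t else 0ℤ)) ⟩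
  sum (λ s → sum (λ t → both s t)) ≡⟨ ∑-comm both ⟩
  sum (λ t → sum (λ s → both s t)) ≡⟨ sum-cong-≗ (λ t → trans (sum-cong-≗ (λ s → if-swap (lookup X s) (lookup Y t)))
                                        (sym (if-sum (lookup Y t) (λ s → if lookup X s then M s t else 0ℤ)))) ⟩
  ⟪ (λ t → ⟪ (λ s → M s t) , X ⟫) , Y ⟫ ∎
  where
  open ≡-Reasoning
  both : Fin n → Fin k → ℤ
  both s t = if lookup X s then (if lookup Y t then M s t else 0ℤ) else 0ℤ
  if-sum : ∀ {m} b (f : Fin m → ℤ) → (if b then sum f else 0ℤ) ≡ sum (λ i → if b then f i else 0ℤ)
  if-sum     true  f = refl
  if-sum {m} false f = sym (sum-0 {m})
  if-swap : ∀ x y {z : ℤ} → (if x then (if y then z else 0ℤ) else 0ℤ) ≡ (if y then (if x then z else 0ℤ) else 0ℤ)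
  if-swap true  true  = refl
  if-swap true  false = refl
  if-swap false true  = refl
  if-swap false false = refl

+-sumFin : ∀ n (f : Fin n → ℕ) → + sumFin n f ≡ sum (λ i → + f i)
+-sumFin zero    f = refl
+-sumFin (suc n) f = cong (λ z → + f zero + z) (+-sumFin n (f ∘ suc))

+-m̃ : ∀ (m : Fin n → ℕ) X → + m̃ m X ≡ ⟪ (λ i → + m i) , X ⟫
+-m̃ {n} m X = trans (+-sumFin n _) (sum-cong-≗ pt)
  where
  pt : ∀ i → + (if lookup X i then m i else 0) ≡ (if lookup X i then + m i else 0ℤ)
  pt i with lookup X i
  ... | true  = refl
  ... | false = refl

+-dS : ∀ (G : SimpleBigraph n k) X Y → + dS G X Y ≡ ⟪ (λ s → ⟪ ⟦ G ⟧ᴹ s , Y ⟫) , X ⟫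
+-dS {n} {k} G X Y = trans (+-sumFin n _) (sum-cong-≗ (λ s → trans (+-sumFin k _) (pt s (lookup X s))))
  where
  pt : ∀ s x → sum (λ t → + (if x ∧ lookup Y t ∧ G s t then 1 else 0)) ≡ (if x then ⟪ ⟦ G ⟧ᴹ s , Y ⟫ else 0ℤ)
  pt s false = sum-0 {k}
  pt s true  = sum-cong-≗ (λ t → if-∧ (lookup Y t) (G s t))
    where
    if-∧ : ∀ y g → + (if y ∧ g then 1 else 0) ≡ (if y then ⟦ g ⟧ else 0ℤ)
    if-∧ true  true  = refl
    if-∧ true  false = refl
    if-∧ false _     = refl

anyFin-intro : ∀ n (f : Fin n → Bool) i → f i ≡ true → anyFin n f ≡ true
anyFin-intro (suc n) f zero    e rewrite e = refl
anyFin-intro (suc n) f (suc i) e rewrite anyFin-intro n (f ∘ suc) i e = Bool.∨-zeroʳ (f zero)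

anyFin-elim : ∀ n (f : Fin n → Bool) → anyFin n f ≡ true → ∃ λ i → f i ≡ true
anyFin-elim (suc n) f e with f zero in e₀
... | true  = zero , e₀
... | false = let i , p = anyFin-elim n (f ∘ suc) e in suc i , p

∧-true : ∀ {x y} → x ∧ y ≡ true → x ≡ true × y ≡ true
∧-true {true} {true} _ = refl , refl

module _ (H : SimpleBigraph n k) (Y : Subset k) (s : Fin n) where

  Γ-intro : ∀ t → lookup Y t ≡ true → H s t ≡ true → lookup (Γ H Y) s ≡ true
  Γ-intro t y h = trans (lookup∘tabulate _ s) (anyFin-intro k _ t (cong₂ _∧_ y h))

  Γ-elim : lookup (Γ H Y) s ≡ true → ∃ λ t → lookup Y t ≡ true × H s t ≡ true
  Γ-elim e = let t , p = anyFin-elim k _ (trans (sym (lookup∘tabulate _ s)) e) in t , ∧-true p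

⟪⟫-member : ∀ {u : Fin n → ℤ} → (∀ i → 0ℤ ≤ u i) → ∀ {X i} → lookup X i ≡ true → u i ≤ ⟪ u , X ⟫
⟪⟫-member {u = u} u≥0 {X} {i} e =
  ≤-trans (≤-reflexive (cong (λ b → if b then u i else 0ℤ) (sym e))) (term≤sum {u = λ i → if lookup X i then u i else 0ℤ} pt i)
  where
  pt : ∀ i → 0ℤ ≤ (if lookup X i then u i else 0ℤ)
  pt i with lookup X i
  ... | true  = u≥0 i
  ... | false = ≤-refl

∪-⊆ : ∀ {A B A′ B′ : Subset n} → A ⊆ A′ → B ⊆ B′ → A ∪ B ⊆ A′ ∪ B′
∪-⊆ {A = A} {B} A⊆ B⊆ x∈ = x∈p∪q⁺ ([ inj₁ ∘ A⊆ , inj₂ ∘ B⊆ ]′ (x∈p∪q⁻ A B x∈))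

∣∣≤sum : ∀ {m} (A : Subset m) {c : Fin m → ℤ} → (∀ s → 0ℤ ≤ c s) → (∀ s → lookup A s ≡ true → 1ℤ ≤ c s) → + ∣ A ∣ ≤ sum c
∣∣≤sum []          c≥0 h = ≤-refl
∣∣≤sum (true ∷ A)  c≥0 h = +-mono-≤ (h zero refl) (∣∣≤sum A (c≥0 ∘ suc) (h ∘ suc))
∣∣≤sum (false ∷ A) c≥0 h = +-mono-≤ (c≥0 zero) (∣∣≤sum A (c≥0 ∘ suc) (h ∘ suc))

module _ (M : Matroid n) where
  open Matroid M

  R : Subset n → ℤ
  R A = + rank A

  R-mono : Monotone R
  R-mono A⊆B = +≤+ (rank-mono A⊆B)

  R-⊥ : R ⊥ ≡ 0ℤ
  R-⊥ = cong +_ (ℕ.n≤0⇒n≡0 (ℕ.≤-trans (rank-≤-card ⊥) (ℕ.≤-reflexive (∣⊥∣≡0 n))))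

  R-submodular : Submodular (𝟚^ n) R
  R-submodular A B = subst (_≤ R A + R B) (+-comm (R (A ∪ B)) (R (A ∩ B))) (+≤+ (rank-submod A B))

  -- Union commutes with joins but not with meets; there only an inclusion holds, and the monotone
  -- rank absorbs it.
  R-∪-submodular : Submodular (𝟚^ n ⊗ 𝟚^ n) (λ (X , W) → R (X ∪ W))
  R-∪-submodular (X , W) (X′ , W′) = ≤-trans
    (+-mono-≤ (R-mono meet) (R-mono join))
    (R-submodular (X ∪ W) (X′ ∪ W′))
    where
    meet : (X ∩ X′) ∪ (W ∩ W′) ⊆ (X ∪ W) ∩ (X′ ∪ W′)
    meet x∈ with x∈p∪q⁻ (X ∩ X′) (W ∩ W′) x∈
    ... | inj₁ y∈ = let a , b = x∈p∩q⁻ X X′ y∈ in x∈p∩q⁺ (p⊆p∪q W a , p⊆p∪q W′ b)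
    ... | inj₂ y∈ = let a , b = x∈p∩q⁻ W W′ y∈ in x∈p∩q⁺ (q⊆p∪q X W a , q⊆p∪q X′ W′ b)
    join : (X ∪ X′) ∪ (W ∪ W′) ⊆ (X ∪ W) ∪ (X′ ∪ W′)
    join x∈ with x∈p∪q⁻ (X ∪ X′) (W ∪ W′) x∈
    ... | inj₁ x∈XX′ = ∪-⊆ (p⊆p∪q W) (p⊆p∪q W′) x∈XX′
    ... | inj₂ x∈WW′ = ∪-⊆ (q⊆p∪q X W) (q⊆p∪q X′ W′) x∈WW′

  -- Each new element raises the rank by at most 1 and is paid for by a unit of `c`, which in the
  -- applications counts the edges that make the element a neighbour.
  rank-growth : ∀ A′ A (c : Fin n → ℤ) → (∀ s → 0ℤ ≤ c s) → (∀ s → lookup A′ s ≡ true → lookup A s ≡ true ⊎ 1ℤ ≤ c s) →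
                R A′ ≤ R A + sum c
  rank-growth A′ A c c≥0 h = ≤-trans (R-mono A′⊆) (≤-trans R-∪-≤ (+-monoʳ-≤ (R A) (≤-trans (+≤+ (rank-≤-card N)) (∣∣≤sum N c≥0 N-1≤))))
    where
    N : Subset n
    N = tabulate (λ s → does (1ℤ ≤? c s))
    N-1≤ : ∀ s → lookup N s ≡ true → 1ℤ ≤ c s
    N-1≤ s e with 1ℤ ≤? c s | trans (sym (lookup∘tabulate (λ s → does (1ℤ ≤? c s)) s)) e
    ... | yes p | _ = p
    A′⊆ : A′ ⊆ A ∪ N
    A′⊆ {x} x∈ with h x ([]=⇒lookup x∈)
    ... | inj₁ e = p⊆p∪q N (lookup⇒[]= x A e)
    ... | inj₂ p = q⊆p∪q A N (lookup⇒[]= x N (trans (lookup∘tabulate _ x) (dec-true (1ℤ ≤? c x) p)))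
    R-∪-≤ : R (A ∪ N) ≤ R A + R N
    R-∪-≤ = ≤-trans (+≤+ (ℕ.m≤m+n (rank (A ∪ N)) (rank (A ∩ N)))) (+≤+ (rank-submod A N))

-- Separation on a disjoint union of two ground sets

⟪⟫-++ : ∀ {m} (u : Fin (m ℕ.+ n) → ℤ) (V : Subset (m ℕ.+ n)) → ⟪ u , V ⟫ ≡ ⟪ (λ i → u (i ↑ˡ n)) , take m V ⟫ + ⟪ (λ i → u (m ↑ʳ i)) , drop m V ⟫
⟪⟫-++ {m = zero}  u V       = sym (+-identityˡ _)
⟪⟫-++ {m = suc m} u (x ∷ V) = trans (cong (λ z → (if x then u zero else 0ℤ) + z) (⟪⟫-++ {m = m} (u ∘ suc) V)) (sym (+-assoc (if x then u zero else 0ℤ) _ _))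

take-⊆ : ∀ {m} {V V′ : Subset (m ℕ.+ n)} → V ⊆ V′ → take m V ⊆ take m V′
take-⊆ {m = suc m} {x ∷ V} {x′ ∷ V′} h here with h here
... | here = here
take-⊆ {m = suc m} {x ∷ V} {x′ ∷ V′} h (there p) = there (take-⊆ (drop-∷-⊆ h) p)

drop-⊆ : ∀ {m} {V V′ : Subset (m ℕ.+ n)} → V ⊆ V′ → drop m V ⊆ drop m V′
drop-⊆ {m = zero}  h p = h p
drop-⊆ {m = suc m} {x ∷ V} {x′ ∷ V′} h p = drop-⊆ {m = m} (drop-∷-⊆ h) p

take-⊥ : ∀ m → take m {n} ⊥ ≡ ⊥
take-⊥ zero    = refl
take-⊥ (suc m) = cong (false ∷_) (take-⊥ m)

drop-⊥ : ∀ m → drop m {n} ⊥ ≡ ⊥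
drop-⊥ zero    = refl
drop-⊥ (suc m) = drop-⊥ m

take-++ : ∀ {m} (X : Subset m) (Y : Subset n) → take m (X ++ Y) ≡ X
take-++ []      Y = refl
take-++ (x ∷ X) Y = cong (x ∷_) (take-++ X Y)

drop-++ : ∀ {m} (X : Subset m) (Y : Subset n) → drop m (X ++ Y) ≡ Y
drop-++ []      Y = refl
drop-++ (x ∷ X) Y = drop-++ X Y

-- A pair of subsets is a single subset of the disjoint union, encoded by concatenation; the
-- separating vector is cut at the seam.
separation₂⁺ : ∀ {m n} (b q : Subset m × Subset n → ℤ) → Submodular (𝟚^ m ⊗ 𝟚^ n) b → Submodular (𝟚^ m ⊗ 𝟚^ n) q →
               (∀ {A A′ B B′} → A ⊆ A′ → B ⊆ B′ → b (A , B) ≤ b (A′ , B′)) → b (⊥ , ⊥) ≡ 0ℤ →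
               (∀ A B → 0ℤ ≤ b (A , B) + q (A , B)) →
               ∃₂ λ (u : Fin m → ℤ) (w : Fin n → ℤ) → (∀ i → 0ℤ ≤ u i) ×
                 (∀ A B → ⟪ u , A ⟫ + ⟪ w , B ⟫ ≤ b (A , B)) × (∀ A B → - (⟪ u , A ⟫ + ⟪ w , B ⟫) ≤ q (A , B))
separation₂⁺ {m} {n} b q sb sq mono b⊥ b+q with separation⁺ (b ∘ split) (q ∘ split) (pull b sb) (pull q sq)
    (λ A⊆B → mono (take-⊆ A⊆B) (drop-⊆ {m = m} A⊆B)) (trans (cong₂ (λ A B → b (A , B)) (take-⊥ m) (drop-⊥ m)) b⊥) (λ V → b+q (take m V) (drop m V))
  where
  split : Subset (m ℕ.+ n) → Subset m × Subset n
  split V = take m V , drop m V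
  pull : ∀ f → Submodular (𝟚^ m ⊗ 𝟚^ n) f → Submodular (𝟚^ (m ℕ.+ n)) (f ∘ split)
  pull f sf V V′ rewrite take-zipWith {m = m} _∧_ V V′ | take-zipWith {m = m} _∨_ V V′ | drop-zipWith {m = m} _∧_ V V′ | drop-zipWith {m = m} _∨_ V V′ = sf (split V) (split V′)
... | uw , uw≥0 , uw≤b , -uw≤q = (λ i → uw (i ↑ˡ n)) , (λ i → uw (m ↑ʳ i)) , (λ i → uw≥0 (i ↑ˡ n)) ,
  (λ A B → subst (_≤ b (A , B)) (sum≡ A B) (subst (λ x → ⟪ uw , A ++ B ⟫ ≤ b x) (cong₂ _,_ (take-++ A B) (drop-++ A B)) (uw≤b (A ++ B)))) ,
  (λ A B → subst (λ z → - z ≤ q (A , B)) (sum≡ A B) (subst (λ x → - ⟪ uw , A ++ B ⟫ ≤ q x) (cong₂ _,_ (take-++ A B) (drop-++ A B)) (-uw≤q (A ++ B))))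
  where
  sum≡ : ∀ A B → ⟪ uw , A ++ B ⟫ ≡ ⟪ (λ i → uw (i ↑ˡ n)) , A ⟫ + ⟪ (λ i → uw (m ↑ʳ i)) , B ⟫
  sum≡ A B = trans (⟪⟫-++ {m = m} uw (A ++ B))
    (cong₂ (λ X Y → ⟪ (λ i → uw (i ↑ˡ n)) , X ⟫ + ⟪ (λ i → uw (m ↑ʳ i)) , Y ⟫) (take-++ A B) (drop-++ A B))

-- The penalty that relaxes the constraint T ⊆ Z.
overflow : (Fin k → ℤ) → Subset k → Subset k → ℤ
overflow m T Z = ⟪ (λ t → if lookup Z t then 0ℤ else m t) , T ⟫

overflow-submodular : ∀ {m : Fin k → ℤ} → (∀ t → 0ℤ ≤ m t) → Submodular (𝟚^ k ⊗ 𝟚^ k) (λ (T , Z) → overflow m T Z)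
overflow-submodular {k} {m} m≥0 = ⟪⟫-⊗-submodular (𝟚^ k) (λ t Z → if lookup Z t then 0ℤ else m t)
  (λ t → record { modular  = λ X Y → trans (cong₂ (λ x y → w t x + w t y) (lookup-zipWith _∧_ t X Y) (lookup-zipWith _∨_ t X Y))
                                       (mod t (lookup X t) (lookup Y t))
                ; antitone = λ X Y → subst (λ z → w t z ≤ w t (lookup X t) × w t z ≤ w t (lookup Y t)) (sym (lookup-zipWith _∨_ t X Y)) (anti t (lookup X t) (lookup Y t)) })
  where
  w : Fin k → Bool → ℤ
  w t b = if b then 0ℤ else m t
  mod : ∀ t x y → w t (x ∧ y) + w t (x ∨ y) ≡ w t x + w t y
  mod t true  true  = refl
  mod t true  false = +-comm (m t) 0ℤ
  mod t false true  = refl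
  mod t false false = refl
  anti : ∀ t x y → w t (x ∨ y) ≤ w t x × w t (x ∨ y) ≤ w t y
  anti t true  true  = ≤-refl , ≤-refl
  anti t true  false = ≤-refl , m≥0 t
  anti t false true  = m≥0 t , ≤-refl
  anti t false false = ≤-refl , ≤-refl

-- The penalty is m(T - Z), exactly the price of enlarging `Z` to Z ∪ T.
⟪⟫-∪-overflow : ∀ (m : Fin k → ℤ) Z T → ⟪ m , Z ∪ T ⟫ ≡ ⟪ m , Z ⟫ + overflow m T Z
⟪⟫-∪-overflow m Z T = trans (sum-cong-≗ pt) (∑-distrib-+ (λ t → if lookup Z t then m t else 0ℤ) (λ t → if lookup T t then (if lookup Z t then 0ℤ else m t) else 0ℤ))
  where
  pt : ∀ t → (if lookup (Z ∪ T) t then m t else 0ℤ) ≡ (if lookup Z t then m t else 0ℤ) + (if lookup T t then (if lookup Z t then 0ℤ else m t) else 0ℤ)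
  pt t rewrite lookup-zipWith _∨_ t Z T with lookup Z t | lookup T t
  ... | true  | true  = sym (+-identityʳ _)
  ... | true  | false = sym (+-identityʳ _)
  ... | false | true  = sym (+-identityˡ _)
  ... | false | false = refl

overflow-self : ∀ (m : Fin k → ℤ) Z → overflow m Z Z ≡ 0ℤ
overflow-self {k} m Z = trans (sum-cong-≗ pt) (sum-0 {k})
  where
  pt : ∀ t → (if lookup Z t then (if lookup Z t then 0ℤ else m t) else 0ℤ) ≡ 0ℤ
  pt t with lookup Z t
  ... | true  = refl
  ... | false = refl

neg-⟪⟫-submodular : ∀ (u : Fin n → ℤ) → Submodular (𝟚^ n) (λ X → - ⟪ u , X ⟫)
neg-⟪⟫-submodular u X Y = ≤-reflexive (trans (sym (neg-distrib-+ ⟪ u , X ∩ Y ⟫ ⟪ u , X ∪ Y ⟫)) (trans (cong -_ (⟪⟫-modular u X Y)) (neg-distrib-+ ⟪ u , X ⟫ ⟪ u , Y ⟫)))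

sum-- : ∀ (f g : Fin n → ℤ) → sum (λ i → f i - g i) ≡ sum f - sum g
sum-- f g = trans (sym (⟪⟫-⊤ (λ i → f i - g i))) (trans (⟪⟫-- f g ⊤) (cong₂ _-_ (⟪⟫-⊤ f) (⟪⟫-⊤ g)))

-- The two directions

module Sufficiency (H : SimpleBigraph n k) (M : Matroid n) (p : Subset k → ℤ) (p-super : FullySupermodular p)
                   (mS : Fin n → ℕ) (mT : Fin k → ℕ) where

  E₀ : SimpleBigraph n k
  E₀ = bipComplement H

  μS : Fin n → ℤ
  μS s = + mS s
  μT : Fin k → ℤ
  μT t = + mT t

  -- `E` is to become G, while `F`, contained in E ∪ H, is a witness of the covering, to be
  -- controlled through its degrees.
  Augmentation : (SimpleBigraph n k → Set) → Set
  Augmentation P = ∃₂ λ E F → E ⊑ E₀ × (∀ s → row E s ≡ μS s) × (∀ t → col E t ≡ μT t) ×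
                     (∀ s t → F s t ≡ true → E₀ s t ≡ true → E s t ≡ true) × P F

  C : Subset n → Subset k → ℤ
  C X Z = ⟪ μT , Z ⟫ + (- ⟪ μS , X ⟫ + cut ⟦ E₀ ⟧ᴹ X Z)

  Hᵀ : Fin k → Fin n → ℤ
  Hᵀ t s = ⟦ H s t ⟧

  cutH : Subset k → Subset n → ℤ
  cutH = cut Hᵀ

  pen : Subset k → Subset k → ℤ
  pen = overflow μT

  module _ (Σ≡ : sum μS ≡ sum μT)
           (C≥0 : ∀ X Z → 0ℤ ≤ C X Z)
           (p≤ : ∀ X Z T → T ⊆ Z → p T ≤ C X Z + R M (X ∪ Γ H T)) where

    μT≥0 : ∀ t → 0ℤ ≤ μT t
    μT≥0 t = +≤+ ℕ.z≤n

    pen-weight≥0 : ∀ Z t → 0ℤ ≤ (if lookup Z t then 0ℤ else μT t)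
    pen-weight≥0 Z t with lookup Z t
    ... | true  = ≤-refl
    ... | false = μT≥0 t

    pen≥0 : ∀ T Z → 0ℤ ≤ pen T Z
    pen≥0 T Z = ⟪⟫-≥0 (pen-weight≥0 Z) T

    cutH≥0 : ∀ T W → 0ℤ ≤ cutH T W
    cutH≥0 = cut-≥0 Hᵀ (λ t s → ⟦⟧-≥0 (H s t))

    cutH-mono : ∀ W → Monotone (λ T → cutH T W)
    cutH-mono W = ⟪⟫-monotone (λ t → ⟪⟫-≥0 (λ s → ⟦⟧-≥0 (H s t)) (∁ W))

    -- Every vertex of Γ(T) outside `W` has an edge counted by `cutH T W`, so the neighbourhood may
    -- be replaced by an arbitrary `W` at this cost.
    R-Γ : ∀ X W T → R M (X ∪ Γ H T) ≤ R M (X ∪ W) + cutH T W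
    R-Γ X W T = ≤-trans (rank-growth M (X ∪ Γ H T) (X ∪ W) c c≥0 grow)
        (+-monoʳ-≤ (R M (X ∪ W)) (≤-reflexive (⟪⟫-comm ⟦ H ⟧ᴹ (∁ W) T)))
      where
      c : Fin n → ℤ
      c s = if lookup (∁ W) s then ⟪ ⟦ H ⟧ᴹ s , T ⟫ else 0ℤ
      c≥0 : ∀ s → 0ℤ ≤ c s
      c≥0 s with lookup (∁ W) s
      ... | true  = ⟪⟫-≥0 (⟦⟧ᴹ-≥0 H s) T
      ... | false = ≤-refl
      grow : ∀ s → lookup (X ∪ Γ H T) s ≡ true → lookup (X ∪ W) s ≡ true ⊎ 1ℤ ≤ c s
      grow s e with lookup-zipWith _∨_ s X (Γ H T) | lookup-zipWith _∨_ s X W | lookup-map s not W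
      ... | e₁ | e₂ | e₃ with lookup X s | lookup W s
      ...   | true  | _     = inj₁ e₂
      ...   | false | true  = inj₁ e₂
      ...   | false | false rewrite e₃ with Γ-elim H T s (trans (sym e₁) e)
      ...     | t , t∈T , h = inj₂ (≤-trans (≤-reflexive (cong ⟦_⟧ (sym h))) (⟪⟫-member (⟦⟧ᴹ-≥0 H s) {T} t∈T))

    cut-E₀-antitone : ∀ X Z T → cut ⟦ E₀ ⟧ᴹ X (Z ∪ T) ≤ cut ⟦ E₀ ⟧ᴹ X Z
    cut-E₀-antitone X Z T = ⟪⟫-mono (λ s → proj₁ (antitone (⟪⟫∁-modularAntitone (⟦ E₀ ⟧ᴹ s) (⟦⟧ᴹ-≥0 E₀ s)) Z T)) X

    D : Subset k → Subset n → Subset k → ℤ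
    D T X Z = C X Z + pen T Z

    Φ : Subset k → Subset n → Subset k → Subset n → ℤ
    Φ T X Z W = D T X Z + (R M (X ∪ W) + cutH T W)

    p≤Φ : ∀ T X Z W → p T ≤ Φ T X Z W
    -- The hypothesis is applied to Z ∪ T: the penalty pays for the enlargement, and the cut can
    -- only shrink.
    p≤Φ T X Z W = ≤-trans (p≤ X (Z ∪ T) T (q⊆p∪q Z T)) (+-mono-≤ C∪≤D (R-Γ X W T))
      where
      eq : ∀ z o x c c′ → ((z + (x + c)) + o) - ((z + o) + (x + c′)) ≡ c - c′
      eq = solve-∀
      C∪≤D : C X (Z ∪ T) ≤ D T X Z
      C∪≤D rewrite ⟪⟫-∪-overflow μT Z T = ≤-from-gap (gap (cut-E₀-antitone X Z T))
        (eq ⟪ μT , Z ⟫ (pen T Z) (- ⟪ μS , X ⟫) (cut ⟦ E₀ ⟧ᴹ X Z) (cut ⟦ E₀ ⟧ᴹ X (Z ∪ T)))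

    D≥0 : ∀ T X Z → 0ℤ ≤ D T X Z
    D≥0 T X Z = C≥0 X Z ⊹ pen≥0 T Z

    C-⊥ : C ⊥ ⊥ ≡ 0ℤ
    C-⊥ rewrite ⟪⟫-⊥ μT | ⟪⟫-⊥ μS | ⟪⟫-⊥ (λ s → ⟪ ⟦ E₀ ⟧ᴹ s , ∁ ⊥ ⟫) = refl

    C-⊤ : C ⊤ ⊤ ≡ 0ℤ
    C-⊤ rewrite ⟪⟫-⊤ μT | ⟪⟫-⊤ μS | cut-⊤ ⟦ E₀ ⟧ᴹ ⊤ | Σ≡ = eq (sum μT)
      where
      eq : ∀ x → x + (- x + 0ℤ) ≡ 0ℤ
      eq = solve-∀

    D-⊥ : D ⊥ ⊥ ⊥ ≡ 0ℤ
    D-⊥ rewrite C-⊥ = trans (+-identityˡ _) (⟪⟫-⊥ {k} (λ t → if lookup (⊥ {k}) t then 0ℤ else μT t))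

    cutH-⊥ : ∀ W → cutH ⊥ W ≡ 0ℤ
    cutH-⊥ W = ⟪⟫-⊥ (λ t → ⟪ Hᵀ t , ∁ W ⟫)

    D-mono : ∀ X Z → Monotone (λ T → D T X Z)
    D-mono X Z A⊆B = +-monoʳ-≤ (C X Z) (⟪⟫-monotone (pen-weight≥0 Z) A⊆B)

    C-submodular : Submodular (𝟚^ n ⊗ 𝟚^ k) (λ (X , Z) → C X Z)
    C-submodular = submodular-+ (𝟚^ n ⊗ 𝟚^ k) {λ (X , Z) → ⟪ μT , Z ⟫} {λ (X , Z) → - ⟪ μS , X ⟫ + cut ⟦ E₀ ⟧ᴹ X Z}
      (λ (X , Z) (X′ , Z′) → ⟪⟫-submodular μT Z Z′)
      (submodular-+ (𝟚^ n ⊗ 𝟚^ k) {λ (X , Z) → - ⟪ μS , X ⟫} {λ (X , Z) → cut ⟦ E₀ ⟧ᴹ X Z}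
        (λ (X , Z) (X′ , Z′) → neg-⟪⟫-submodular μS X X′)
        (cut-submodular ⟦ E₀ ⟧ᴹ (⟦⟧ᴹ-≥0 E₀)))

    cutH-submodular : Submodular (𝟚^ k ⊗ 𝟚^ n) (λ (T , W) → cutH T W)
    cutH-submodular = cut-submodular Hᵀ (λ t s → ⟦⟧-≥0 (H s t))

    D-submodular : Submodular ((𝟚^ k ⊗ 𝟚^ n) ⊗ 𝟚^ k) (λ ((T , X) , Z) → D T X Z)
    D-submodular = submodular-+ ((𝟚^ k ⊗ 𝟚^ n) ⊗ 𝟚^ k) {λ ((T , X) , Z) → C X Z} {λ ((T , X) , Z) → pen T Z}
      (λ ((T , X) , Z) ((T′ , X′) , Z′) → C-submodular (X , Z) (X′ , Z′))
      (λ ((T , X) , Z) ((T′ , X′) , Z′) → overflow-submodular μT≥0 (T , Z) (T′ , Z′))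

    Φ-submodular : Submodular (((𝟚^ k ⊗ 𝟚^ n) ⊗ 𝟚^ k) ⊗ 𝟚^ n) (λ (((T , X) , Z) , W) → Φ T X Z W)
    Φ-submodular = submodular-+ L {λ (((T , X) , Z) , W) → D T X Z} {λ (((T , X) , Z) , W) → R M (X ∪ W) + cutH T W}
      (λ (x , W) (x′ , W′) → D-submodular x x′)
      (submodular-+ L {λ (((T , X) , Z) , W) → R M (X ∪ W)} {λ (((T , X) , Z) , W) → cutH T W}
        (λ (((T , X) , Z) , W) (((T′ , X′) , Z′) , W′) → R-∪-submodular M (X , W) (X′ , W′))
        (λ (((T , X) , Z) , W) (((T′ , X′) , Z′) , W′) → cutH-submodular (T , W) (T′ , W′)))
      where
      L : Lat
      L = ((𝟚^ k ⊗ 𝟚^ n) ⊗ 𝟚^ k) ⊗ 𝟚^ n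

    -- From p to the vector ν

    module V where
      b₁ : Subset k → Subset n → Subset k → ℤ
      b₁ T X Z = minS (Φ T X Z)
      b₂ : Subset k → Subset n → ℤ
      b₂ T X = minS (b₁ T X)
      b : Subset k → ℤ
      b T = minS (b₂ T)

      b≤ : ∀ T X Z W → b T ≤ Φ T X Z W
      b≤ T X Z W = ≤-trans (minS-≤ (b₂ T) X) (≤-trans (minS-≤ (b₁ T X) Z) (minS-≤ (Φ T X Z) W))

      b-glb : ∀ T {z} → (∀ X Z W → z ≤ Φ T X Z W) → z ≤ b T
      b-glb T h = minS-glb (b₂ T) (λ X → minS-glb (b₁ T X) (λ Z → minS-glb (Φ T X Z) (h X Z)))

      b-submodular : Submodular (𝟚^ k) b
      b-submodular = minS-submodular (𝟚^ k) (λ (T , X) → b₂ T X)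
        (minS-submodular (𝟚^ k ⊗ 𝟚^ n) (λ ((T , X) , Z) → b₁ T X Z)
          (minS-submodular ((𝟚^ k ⊗ 𝟚^ n) ⊗ 𝟚^ k) (λ (((T , X) , Z) , W) → Φ T X Z W) Φ-submodular))

      -p-submodular : Submodular (𝟚^ k) (λ T → - p T)
      -p-submodular A B = ≤-from-gap (gap (p-super A B)) (eq (p A) (p B) (p (A ∩ B)) (p (A ∪ B)))
        where
        eq : ∀ a b c d → (- a + - b) - (- c + - d) ≡ (c + d) - (a + b)
        eq = solve-∀

      b-mono : Monotone b
      b-mono {A} {B} A⊆B = b-glb B (λ X Z W → ≤-trans (b≤ A X Z W)
        (+-mono-≤ (D-mono X Z A⊆B) (+-monoʳ-≤ (R M (X ∪ W)) (cutH-mono W A⊆B))))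

      b⊥ : b ⊥ ≡ 0ℤ
      b⊥ = ≤-antisym (≤-trans (b≤ ⊥ ⊥ ⊥ ⊥) (≤-reflexive Φ⊥))
             (b-glb ⊥ (λ X Z W → D≥0 ⊥ X Z ⊹ (+≤+ ℕ.z≤n ⊹ cutH≥0 ⊥ W)))
        where
        Φ⊥ : Φ ⊥ ⊥ ⊥ ⊥ ≡ 0ℤ
        Φ⊥ rewrite D-⊥ | ∪-idem (⊥ {n}) | R-⊥ M | cutH-⊥ ⊥ = refl

      Sep : Set
      Sep = ∃ λ (ν : Fin k → ℤ) → (∀ t → 0ℤ ≤ ν t) × (∀ T → ⟪ ν , T ⟫ ≤ b T) × (∀ T → - ⟪ ν , T ⟫ ≤ - p T)
      sep : Sep
      sep = separation⁺ b (λ T → - p T) b-submodular -p-submodular b-mono b⊥ (λ T → gap (b-glb T (p≤Φ T)))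

    exists-ν : ∃ λ (ν : Fin k → ℤ) → (∀ t → 0ℤ ≤ ν t) × (∀ T X Z W → ⟪ ν , T ⟫ ≤ Φ T X Z W) × (∀ T → p T ≤ ⟪ ν , T ⟫)
    exists-ν = unpack V.sep
      where
      eq : ∀ a b → b - a ≡ - a - - b
      eq = solve-∀
      unpack : V.Sep → _
      unpack (ν , ν≥0 , ν≤b , -ν≤-p) = ν , ν≥0 , (λ T X Z W → ≤-trans (ν≤b T) (V.b≤ T X Z W)) ,
                                       (λ T → ≤-from-gap (gap (-ν≤-p T)) (eq (p T) ⟪ ν , T ⟫))

    module _ (ν : Fin k → ℤ) (ν≥0 : ∀ t → 0ℤ ≤ ν t) (ν≤Φ : ∀ T X Z W → ⟪ ν , T ⟫ ≤ Φ T X Z W) where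

      Σν≥0 : 0ℤ ≤ sum ν
      Σν≥0 = sum-≥0 ν≥0

      -- From the rank to the vectors u₁ and u₂

      module U where
        -- The truncation forces sum u₁ + sum u₂ ≡ sum ν.
        b : Subset n × Subset n → ℤ
        b (X , W) = R M (X ∪ W) ⊓ sum ν

        Ψ : Subset n × Subset n → Subset k → Subset k → ℤ
        Ψ (X , W) Z T = D T X Z + (cutH T W + - ⟪ ν , T ⟫)
        q₁ : Subset n × Subset n → Subset k → ℤ
        q₁ x Z = minS (Ψ x Z)
        q : Subset n × Subset n → ℤ
        q x = minS (q₁ x)

        q≤ : ∀ x Z T → q x ≤ Ψ x Z T
        q≤ x Z T = ≤-trans (minS-≤ (q₁ x) Z) (minS-≤ (Ψ x Z) T)

        b-submodular : Submodular (𝟚^ n ⊗ 𝟚^ n) b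
        b-submodular = submodular-⊓ (𝟚^ n ⊗ 𝟚^ n) {λ (X , W) → R M (X ∪ W)} (sum ν) (R-∪-submodular M)
          (λ (X , W) (X′ , W′) → R-mono M (∪-⊆ (p∩q⊆p X X′) (p∩q⊆p W W′)))
          (λ (X , W) (X′ , W′) → R-mono M (∪-⊆ (p∩q⊆q X X′) (p∩q⊆q W W′)))

        q-submodular : Submodular (𝟚^ n ⊗ 𝟚^ n) q
        q-submodular = minS-submodular (𝟚^ n ⊗ 𝟚^ n) (λ (x , Z) → q₁ x Z)
          (minS-submodular ((𝟚^ n ⊗ 𝟚^ n) ⊗ 𝟚^ k) (λ ((x , Z) , T) → Ψ x Z T)
            (submodular-+ L {λ (((X , W) , Z) , T) → D T X Z} {λ (((X , W) , Z) , T) → cutH T W + - ⟪ ν , T ⟫}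
              (λ (((X , W) , Z) , T) (((X′ , W′) , Z′) , T′) → D-submodular ((T , X) , Z) ((T′ , X′) , Z′))
              (submodular-+ L {λ (((X , W) , Z) , T) → cutH T W} {λ (((X , W) , Z) , T) → - ⟪ ν , T ⟫}
                (λ (((X , W) , Z) , T) (((X′ , W′) , Z′) , T′) → cutH-submodular (T , W) (T′ , W′))
                (λ (((X , W) , Z) , T) (((X′ , W′) , Z′) , T′) → neg-⟪⟫-submodular ν T T′))))
          where
          L : Lat
          L = ((𝟚^ n ⊗ 𝟚^ n) ⊗ 𝟚^ k) ⊗ 𝟚^ k

        b+q≥0 : ∀ X W → 0ℤ ≤ b (X , W) + q (X , W)
        b+q≥0 X W with minS-attained (q₁ (X , W))
        ... | Z , e with minS-attained (Ψ (X , W) Z)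
        ...   | T , e′ rewrite e | e′ with ⊓-sel (R M (X ∪ W)) (sum ν)
        ...     | inj₁ e″ rewrite e″ = ≤-from-gap (gap (ν≤Φ T X Z W)) (eq (D T X Z) (R M (X ∪ W)) (cutH T W) ⟪ ν , T ⟫)
          where
          eq : ∀ d r c x → (r + (d + (c + - x))) - 0ℤ ≡ (d + (r + c)) - x
          eq = solve-∀
        -- Where the truncation is active, the total of ν alone dominates ν(T), since ν ≥ 0.
        ...     | inj₂ e″ rewrite e″ = ≤-from-gap (D≥0 T X Z ⊹ cutH≥0 T W ⊹ gap (≤-trans (⟪⟫-monotone ν≥0 {T} ⊆⊤) (≤-reflexive (⟪⟫-⊤ ν))))
                                           (eq (D T X Z) (sum ν) (cutH T W) ⟪ ν , T ⟫)
          where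
          eq : ∀ d r c x → (r + (d + (c + - x))) - 0ℤ ≡ (d + c) + (r - x)
          eq = solve-∀

        b⊥ : b (⊥ , ⊥) ≡ 0ℤ
        b⊥ rewrite ∪-idem (⊥ {n}) | R-⊥ M = i≤j⇒i⊓j≡i Σν≥0

        Sep : Set
        Sep = ∃₂ λ (u₁ u₂ : Fin n → ℤ) → (∀ s → 0ℤ ≤ u₁ s) ×
          (∀ X W → ⟪ u₁ , X ⟫ + ⟪ u₂ , W ⟫ ≤ b (X , W)) × (∀ X W → - (⟪ u₁ , X ⟫ + ⟪ u₂ , W ⟫) ≤ q (X , W))
        sep : Sep
        sep = separation₂⁺ b q b-submodular q-submodular (λ A⊆ B⊆ → ⊓-monoˡ-≤ (sum ν) (R-mono M (∪-⊆ A⊆ B⊆))) b⊥ b+q≥0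

      exists-u : ∃₂ λ (u₁ u₂ : Fin n → ℤ) → (∀ s → 0ℤ ≤ u₁ s) ×
        (∀ X W → ⟪ u₁ , X ⟫ + ⟪ u₂ , W ⟫ ≤ R M (X ∪ W)) × sum u₁ + sum u₂ ≤ sum ν ×
        (∀ T X Z W → 0ℤ ≤ (D T X Z + ⟪ u₁ , X ⟫) + ((cutH T W + ⟪ u₂ , W ⟫) + - ⟪ ν , T ⟫))
      exists-u = unpack U.sep
        where
        eq : ∀ d c x a b → ((d + a) + ((c + b) + - x)) - 0ℤ ≡ (d + (c + - x)) - - (a + b)
        eq = solve-∀
        unpack : U.Sep → _
        unpack (u₁ , u₂ , u₁≥0 , u≤b , -u≤q) = u₁ , u₂ , u₁≥0 ,
          (λ X W → ≤-trans (u≤b X W) (i⊓j≤i (R M (X ∪ W)) (sum ν))) ,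
          subst (_≤ sum ν) (cong₂ _+_ (⟪⟫-⊤ u₁) (⟪⟫-⊤ u₂)) (≤-trans (u≤b ⊤ ⊤) (i⊓j≤j (R M (⊤ ∪ ⊤)) (sum ν))) ,
          (λ T X Z W → ≤-from-gap (gap (≤-trans (-u≤q X W) (U.q≤ (X , W) Z T)))
            (eq (D T X Z) (cutH T W) ⟪ ν , T ⟫ ⟪ u₁ , X ⟫ ⟪ u₂ , W ⟫))

    module _ (ν : Fin k → ℤ) (ν≥0 : ∀ t → 0ℤ ≤ ν t) (u₁ u₂ : Fin n → ℤ) (u₁≥0 : ∀ s → 0ℤ ≤ u₁ s)
             (u≤R : ∀ X W → ⟪ u₁ , X ⟫ + ⟪ u₂ , W ⟫ ≤ R M (X ∪ W)) (Σu≤Σν : sum u₁ + sum u₂ ≤ sum ν)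
             (ν≤u : ∀ T X Z W → 0ℤ ≤ (D T X Z + ⟪ u₁ , X ⟫) + ((cutH T W + ⟪ u₂ , W ⟫) + - ⟪ ν , T ⟫)) where

      -- Both copies of S are evaluated at the singleton of `s`, whose rank is at most 1.
      u≤1 : ∀ s → u₁ s + u₂ s ≤ 1ℤ
      u≤1 s = ≤-trans (≤-reflexive (sym (cong₂ _+_ (⟪⟫-⁅⁆ u₁ s) (⟪⟫-⁅⁆ u₂ s)))) (≤-trans (u≤R ⁅ s ⁆ ⁅ s ⁆)
        (+≤+ (ℕ.≤-trans (Matroid.rank-≤-card M (⁅ s ⁆ ∪ ⁅ s ⁆)) (ℕ.≤-reflexive (trans (cong ∣_∣ (∪-idem ⁅ s ⁆)) (∣⁅x⁆∣≡1 s))))))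

      -- Splitting ν into v₁ and v₂

      module W where
        g : Subset k → Subset n → Subset k → ℤ
        g T X Z = D T X Z + ⟪ u₁ , X ⟫
        b₁ : Subset k → Subset n → ℤ
        b₁ T X = minS (g T X)
        b : Subset k → ℤ
        b T = minS (b₁ T)

        h : Subset k → Subset n → ℤ
        h T W = cutH T W + ⟪ u₂ , W ⟫
        c : Subset k → ℤ
        c T = minS (h T)

        b≤ : ∀ T X Z → b T ≤ g T X Z
        b≤ T X Z = ≤-trans (minS-≤ (b₁ T) X) (minS-≤ (g T X) Z)

        b-glb : ∀ T {z} → (∀ X Z → z ≤ g T X Z) → z ≤ b T
        b-glb T h = minS-glb (b₁ T) (λ X → minS-glb (g T X) (h X))

        b-submodular : Submodular (𝟚^ k) b
        b-submodular = minS-submodular (𝟚^ k) (λ (T , X) → b₁ T X)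
          (minS-submodular (𝟚^ k ⊗ 𝟚^ n) (λ ((T , X) , Z) → g T X Z)
            (submodular-+ ((𝟚^ k ⊗ 𝟚^ n) ⊗ 𝟚^ k) {λ ((T , X) , Z) → D T X Z} {λ ((T , X) , Z) → ⟪ u₁ , X ⟫} D-submodular
              (λ ((T , X) , Z) ((T′ , X′) , Z′) → ⟪⟫-submodular u₁ X X′)))

        c-submodular : Submodular (𝟚^ k) c
        c-submodular = minS-submodular (𝟚^ k) (λ (T , W) → h T W)
          (submodular-+ (𝟚^ k ⊗ 𝟚^ n) {λ (T , W) → cutH T W} {λ (T , W) → ⟪ u₂ , W ⟫} cutH-submodular
            (λ (T , W) (T′ , W′) → ⟪⟫-submodular u₂ W W′))

        q : Subset k → ℤ
        q T = c T + - ⟪ ν , T ⟫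

        q-submodular : Submodular (𝟚^ k) q
        q-submodular = submodular-+ (𝟚^ k) {c} {λ T → - ⟪ ν , T ⟫} c-submodular (neg-⟪⟫-submodular ν)

        b-mono : Monotone b
        b-mono {A} {B} A⊆B = b-glb B (λ X Z → ≤-trans (b≤ A X Z) (+-monoˡ-≤ ⟪ u₁ , X ⟫ (D-mono X Z A⊆B)))

        c-mono : Monotone c
        c-mono {A} {B} A⊆B = minS-glb (h B) (λ W → ≤-trans (minS-≤ (h A) W) (+-monoˡ-≤ ⟪ u₂ , W ⟫ (cutH-mono W A⊆B)))

        b⊥ : b ⊥ ≡ 0ℤ
        b⊥ = ≤-antisym (≤-trans (b≤ ⊥ ⊥ ⊥) (≤-reflexive (cong₂ _+_ D-⊥ (⟪⟫-⊥ u₁))))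
               (b-glb ⊥ (λ X Z → D≥0 ⊥ X Z ⊹ ⟪⟫-≥0 u₁≥0 X))

        b+q≥0 : ∀ T → 0ℤ ≤ b T + q T
        b+q≥0 T with minS-attained (b₁ T)
        ... | X , e with minS-attained (g T X)
        ...   | Z , e′ with minS-attained (h T)
        ...     | W , e″ rewrite e | e′ | e″ = ν≤u T X Z W

        Sep : Set
        Sep = ∃ λ (m : Fin k → ℤ) → (∀ t → 0ℤ ≤ m t) × (∀ T → ⟪ m , T ⟫ ≤ b T) × (∀ T → - ⟪ m , T ⟫ ≤ q T)
        sep : Sep
        sep = separation⁺ b q b-submodular q-submodular b-mono b⊥ b+q≥0

      exists-split : ∃₂ λ (v₁ v₂ : Fin k → ℤ) → (∀ t → 0ℤ ≤ v₁ t) × (∀ t → v₁ t ≡ ν t - v₂ t) ×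
        (∀ X Z → ⟪ v₁ , Z ⟫ ≤ C X Z + ⟪ u₁ , X ⟫) × (∀ T W → ⟪ v₂ , T ⟫ ≤ cutH T W + ⟪ u₂ , W ⟫)
      exists-split = unpack W.sep
        where
        unpack : W.Sep → _
        unpack (m , m≥0 , m≤b , -m≤q) = v₁ , v₂ , v₁≥0 , (λ _ → refl) , v₁≤C , v₂≤c
          where
          v₁ v₂ : Fin k → ℤ
          -- `m` may exceed ν, so v₁ becomes min(m , ν) and v₂ the positive part of ν - m; the
          -- monotone `c` still bounds the latter.
          v₂ t = (ν t - m t) ⊔ 0ℤ
          v₁ t = ν t - v₂ t

          rest≤c : ∀ T → ⟪ (λ t → ν t - m t) , T ⟫ ≤ W.c T
          rest≤c T = subst (_≤ W.c T) (sym (⟪⟫-- ν m T)) (≤-from-gap (gap (-m≤q T)) (eq (W.c T) ⟪ ν , T ⟫ ⟪ m , T ⟫))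
            where
            eq : ∀ c x y → c - (x - y) ≡ (c + - x) - - y
            eq = solve-∀

          v₂≤c : ∀ T W → ⟪ v₂ , T ⟫ ≤ cutH T W + ⟪ u₂ , W ⟫
          v₂≤c T W = ≤-trans (⟪⟫-⊔0-≤ (λ t → ν t - m t) W.c W.c-mono rest≤c T) (minS-≤ (W.h T) W)

          v₁≥0 : ∀ t → 0ℤ ≤ v₁ t
          v₁≥0 t = gap (⊔-lub (i-j≤i (ν t) (m t) {{ℤ.nonNegative (m≥0 t)}}) (ν≥0 t))

          v₁≤m : ∀ t → v₁ t ≤ m t
          v₁≤m t = ≤-from-gap (gap (i≤i⊔j (ν t - m t) 0ℤ)) (eq (ν t) (m t) (v₂ t))
            where
            eq : ∀ a b c → b - (a - c) ≡ c - (a - b)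
            eq = solve-∀

          v₁≤C : ∀ X Z → ⟪ v₁ , Z ⟫ ≤ C X Z + ⟪ u₁ , X ⟫
          -- The bound is used with T = Z, where the penalty vanishes.
          v₁≤C X Z = subst (λ z → ⟪ v₁ , Z ⟫ ≤ z + ⟪ u₁ , X ⟫)
            (trans (cong (λ z → C X Z + z) (overflow-self μT Z)) (+-identityʳ (C X Z)))
            (≤-trans (⟪⟫-mono v₁≤m Z) (≤-trans (m≤b Z) (W.b≤ Z X Z)))

      module _ (v₁ v₂ : Fin k → ℤ) (v₁≥0 : ∀ t → 0ℤ ≤ v₁ t) (v₁≡ : ∀ t → v₁ t ≡ ν t - v₂ t)
               (v₁≤C : ∀ X Z → ⟪ v₁ , Z ⟫ ≤ C X Z + ⟪ u₁ , X ⟫) (v₂≤c : ∀ T W → ⟪ v₂ , T ⟫ ≤ cutH T W + ⟪ u₂ , W ⟫) where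

        Σv₁≤Σu₁ : sum v₁ ≤ sum u₁
        Σv₁≤Σu₁ = ≤-trans (≤-reflexive (sym (⟪⟫-⊤ v₁))) (≤-trans (v₁≤C ⊤ ⊤)
          (≤-reflexive (trans (cong₂ _+_ C-⊤ (⟪⟫-⊤ u₁)) (+-identityˡ (sum u₁)))))

        Σv₂≤Σu₂ : sum v₂ ≤ sum u₂
        Σv₂≤Σu₂ = ≤-trans (≤-reflexive (sym (⟪⟫-⊤ v₂))) (≤-trans (v₂≤c ⊤ ⊤)
          (≤-reflexive (trans (cong₂ _+_ (cut-⊤ Hᵀ ⊤) (⟪⟫-⊤ u₂)) (+-identityˡ (sum u₂)))))

        Σν≡ : sum ν ≡ sum v₁ + sum v₂
        Σν≡ = sym (trans (cong (_+ sum v₂) (trans (sum-cong-≗ v₁≡) (sum-- ν v₂))) (eq (sum ν) (sum v₂)))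
          where
          eq : ∀ a b → (a - b) + b ≡ a
          eq = solve-∀

        -- The supply-demand theorem needs equal totals. Each vᵢ has total at most that of uᵢ, while
        -- the truncation bounds the total of u₁ + u₂ by that of ν = v₁ + v₂; so equality holds
        -- throughout.
        Σu₁≡Σv₁ : sum u₁ ≡ sum v₁
        Σu₁≡Σv₁ = ≤-antisym (≤-from-gap (gap Σu≤Σν ⊹ gap Σv₂≤Σu₂)
            (trans (eq (sum u₁) (sum u₂) (sum v₁) (sum v₂)) (cong (λ z → (z - (sum u₁ + sum u₂)) + (sum u₂ - sum v₂)) (sym Σν≡)))) Σv₁≤Σu₁
          where
          eq : ∀ a b c d → c - a ≡ ((c + d) - (a + b)) + (b - d)
          eq = solve-∀

        Σu₂≡Σv₂ : sum u₂ ≡ sum v₂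
        Σu₂≡Σv₂ = ≤-antisym (≤-from-gap (gap Σu≤Σν ⊹ gap Σv₁≤Σu₁)
            (trans (eq (sum u₁) (sum u₂) (sum v₁) (sum v₂)) (cong (λ z → (z - (sum u₁ + sum u₂)) + (sum u₁ - sum v₁)) (sym Σν≡)))) Σv₂≤Σu₂
          where
          eq : ∀ a b c d → d - b ≡ ((c + d) - (a + b)) + (a - c)
          eq = solve-∀

        tE : Transport E₀ μS μT
        tE = transport E₀ μS μT Σ≡ cond
          where
          eq : ∀ z x c → (z + c) - x ≡ (z + (- x + c)) - 0ℤ
          eq = solve-∀
          cond : ∀ X Z → ⟪ μS , X ⟫ ≤ ⟪ μT , Z ⟫ + cut ⟦ E₀ ⟧ᴹ X Z
          cond X Z = ≤-from-gap (gap (C≥0 X Z)) (eq ⟪ μT , Z ⟫ ⟪ μS , X ⟫ (cut ⟦ E₀ ⟧ᴹ X Z))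

        tB : Transport E₀ (λ s → μS s - u₁ s) (λ t → μT t - v₁ t)
        tB = transport E₀ (λ s → μS s - u₁ s) (λ t → μT t - v₁ t)
               (trans (sum-- μS u₁) (trans (cong₂ _-_ Σ≡ Σu₁≡Σv₁) (sym (sum-- μT v₁)))) cond
          where
          eq : ∀ z x c u v → ((z - v) + c) - (x - u) ≡ ((z + (- x + c)) + u) - v
          eq = solve-∀
          cond : ∀ X Z → ⟪ (λ s → μS s - u₁ s) , X ⟫ ≤ ⟪ (λ t → μT t - v₁ t) , Z ⟫ + cut ⟦ E₀ ⟧ᴹ X Z
          cond X Z rewrite ⟪⟫-- μS u₁ X | ⟪⟫-- μT v₁ Z =
            ≤-from-gap (gap (v₁≤C X Z)) (eq ⟪ μT , Z ⟫ ⟪ μS , X ⟫ (cut ⟦ E₀ ⟧ᴹ X Z) ⟪ u₁ , X ⟫ ⟪ v₁ , Z ⟫)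

        tF : Transport H u₂ v₂
        tF = transport H u₂ v₂ Σu₂≡Σv₂ cond
          where
          cut≡ : ∀ X Z → cutH (∁ Z) (∁ X) ≡ cut ⟦ H ⟧ᴹ X Z
          cut≡ X Z = trans (⟪⟫-cong (λ t → ⟪⟫-∁∁ (Hᵀ t) X) (∁ Z)) (sym (⟪⟫-comm ⟦ H ⟧ᴹ X (∁ Z)))
          eq : ∀ u v x z c → (z + c) - x ≡ ((c + (u - x)) - (v - z)) + (v - u)
          eq = solve-∀
          cond : ∀ X Z → ⟪ u₂ , X ⟫ ≤ ⟪ v₂ , Z ⟫ + cut ⟦ H ⟧ᴹ X Z
          cond X Z = ≤-from-gap (gap step ⊹ gap (≤-reflexive Σu₂≡Σv₂)) (eq (sum u₂) (sum v₂) ⟪ u₂ , X ⟫ ⟪ v₂ , Z ⟫ (cut ⟦ H ⟧ᴹ X Z))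
            where
            step : sum v₂ - ⟪ v₂ , Z ⟫ ≤ cut ⟦ H ⟧ᴹ X Z + (sum u₂ - ⟪ u₂ , X ⟫)
            -- The bound on v₂ at the complements is the supply-demand condition read from the side
            -- of T.
            step = subst₂ _≤_ (⟪⟫-∁-≡ v₂ Z) (cong₂ _+_ (cut≡ X Z) (⟪⟫-∁-≡ u₂ X)) (v₂≤c (∁ Z) (∁ X))

        realization : Augmentation (λ F → (∀ t → col F t ≡ ν t) × (∀ s → row F s ≤ u₁ s + u₂ s))
        realization = combine tE tB tF
          where
          eq₁ : ∀ a b → a - (a - b) ≡ b
          eq₁ = solve-∀
          eq₂ : ∀ u m w → w + (m - (m - u)) ≡ u + w
          eq₂ = solve-∀
          eq₃ : ∀ w a m → w + (m - (m - (a - w))) ≡ a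
          eq₃ = solve-∀
          combine : Transport E₀ μS μT → Transport E₀ (λ s → μS s - u₁ s) (λ t → μT t - v₁ t) → Transport H u₂ v₂ → _
          combine (E , E⊑ , rE , cE) (B , B⊑ , rB , cB) (F , F⊑ , rF , cF) = conclude
            (realize E₀ ℤ.∣ dist E B ∣ E B F (≤-reflexive (sym (0≤i⇒+∣i∣≡i (dist-≥0 E B)))) E⊑ B⊑
               -- `F` starts inside `H`, so none of its edges lies in `E₀` and `Settled` is vacuous.
               (λ s t f e → contradiction (trans (sym e) (cong not (F⊑ s t f))) λ ())
               (λ s → subst₂ _≤_ (sym (rB s)) (sym (rE s)) (≤-from-gap (u₁≥0 s) (eq₁ (μS s) (u₁ s))))
               (λ t → subst₂ _≤_ (sym (cB t)) (sym (cE t)) (≤-from-gap (v₁≥0 t) (eq₁ (μT t) (v₁ t))))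
               (λ s → ≤-trans (≤-reflexive (rows s)) (u≤1 s)))
            where
            rows : ∀ s → row F s + (row E s - row B s) ≡ u₁ s + u₂ s
            rows s = trans (cong₂ _+_ (rF s) (cong₂ _-_ (rE s) (rB s))) (eq₂ (u₁ s) (μS s) (u₂ s))
            cols : ∀ t → col F t + (col E t - col B t) ≡ ν t
            cols t = trans (cong₂ _+_ (cF t) (cong₂ _-_ (cE t) (trans (cB t) (cong (λ z → μT t - z) (v₁≡ t))))) (eq₃ (v₂ t) (ν t) (μT t))
            conclude : Realization E₀ E B F → _
            conclude (E* , F* , E*⊑ , rE* , cE* , F*⊆ , cF* , rF*) =
              E* , F* , E*⊑ , (λ s → trans (rE* s) (rE s)) , (λ t → trans (cE* t) (cE t)) , F*⊆ ,
              (λ t → trans (cF* t) (cols t)) , (λ s → ≤-trans (rF* s) (≤-reflexive (rows s)))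

    sufficiency : Augmentation (λ F → (∀ T → p T ≤ ⟪ col F , T ⟫) × (∀ A → ⟪ row F , A ⟫ ≤ R M A))
    sufficiency =
      let ν , ν≥0 , ν≤Φ , p≤ν = exists-ν
          u₁ , u₂ , u₁≥0 , u≤R , Σu≤Σν , ν≤u = exists-u ν ν≥0 ν≤Φ
          v₁ , v₂ , v₁≥0 , v₁≡ , v₁≤C , v₂≤c = exists-split ν ν≥0 u₁ u₂ u₁≥0 u≤R Σu≤Σν ν≤u
      in finish ν p≤ν u₁ u₂ u≤R (realization ν ν≥0 u₁ u₂ u₁≥0 u≤R Σu≤Σν ν≤u v₁ v₂ v₁≥0 v₁≡ v₁≤C v₂≤c)
      where
      finish : ∀ ν → (∀ T → p T ≤ ⟪ ν , T ⟫) → ∀ u₁ u₂ → (∀ X W → ⟪ u₁ , X ⟫ + ⟪ u₂ , W ⟫ ≤ R M (X ∪ W)) →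
               Augmentation (λ F → (∀ t → col F t ≡ ν t) × (∀ s → row F s ≤ u₁ s + u₂ s)) →
               Augmentation (λ F → (∀ T → p T ≤ ⟪ col F , T ⟫) × (∀ A → ⟪ row F , A ⟫ ≤ R M A))
      finish ν p≤ν u₁ u₂ u≤R (E , F , E⊑ , rE , cE , F⊆ , cF , rF) =
        E , F , E⊑ , rE , cE , F⊆ ,
        (λ T → ≤-trans (p≤ν T) (≤-reflexive (⟪⟫-cong (λ t → sym (cF t)) T))) ,
        (λ A → ≤-trans (⟪⟫-mono rF A) (≤-trans (≤-reflexive (⟪⟫-+ u₁ u₂ A))
                 (subst (λ B → ⟪ u₁ , A ⟫ + ⟪ u₂ , A ⟫ ≤ R M B) (∪-idem A) (u≤R A A))))

⟪sum⟫ : ∀ (M : Fin n → Fin k → ℤ) Y → ⟪ (λ t → sum (λ s → M s t)) , Y ⟫ ≡ sum (λ s → ⟪ M s , Y ⟫)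
⟪sum⟫ {n} M Y = trans (⟪⟫-cong (λ t → sym (⟪⟫-⊤ (λ s → M s t))) Y)
  (trans (sym (⟪⟫-comm M ⊤ Y)) (⟪⟫-⊤ (λ s → ⟪ M s , Y ⟫)))

-- An edge of `F` with one end in `Y` has the other in the neighbourhood of `Y`, where the rows
-- count it.
⟪col⟫≤⟪row⟫ : ∀ (F K : SimpleBigraph n k) → F ⊑ K → ∀ Y → ⟪ col F , Y ⟫ ≤ ⟪ row F , Γ K Y ⟫
⟪col⟫≤⟪row⟫ {n} {k} F K F⊑K Y = ≤-trans (≤-reflexive (⟪sum⟫ ⟦ F ⟧ᴹ Y)) (sum-mono pt)
  where
  pt : ∀ s → ⟪ ⟦ F ⟧ᴹ s , Y ⟫ ≤ (if lookup (Γ K Y) s then row F s else 0ℤ)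
  pt s with lookup (Γ K Y) s in e
  ... | true  = ≤-trans (⟪⟫-monotone (⟦⟧ᴹ-≥0 F s) {Y} ⊆⊤) (≤-reflexive (⟪⟫-⊤ (⟦ F ⟧ᴹ s)))
  ... | false = ≤-reflexive (trans (sum-cong-≗ zero-term) (sum-0 {k}))
    where
    zero-term : ∀ t → (if lookup Y t then ⟦ F s t ⟧ else 0ℤ) ≡ 0ℤ
    zero-term t with lookup Y t in y | F s t in f
    ... | false | _     = refl
    ... | true  | false = refl
    ... | true  | true  = contradiction (trans (sym e) (Γ-intro K Y s t y (F⊑K s t f))) λ ()

indicator : SimpleBigraph n k → Bigraph n k
indicator E s t = if E s t then 1 else 0

+-indicator : ∀ b → + (if b then 1 else 0) ≡ ⟦ b ⟧
+-indicator true  = refl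
+-indicator false = refl

-- Necessity by counting the edges of G

module Necessity (H : SimpleBigraph n k) (M : Matroid n) (p : Subset k → ℤ) (G : Bigraph n k)
                 (simple : IsSimple (G +ᴳ H)) (covers : Covers M (G +ᴳ H) p) where

  g : Fin n → Fin k → ℤ
  g s t = + G s t

  g≥0 : ∀ s t → 0ℤ ≤ g s t
  g≥0 s t = +≤+ ℕ.z≤n

  g≤E₀ : ∀ s t → g s t ≤ ⟦ bipComplement H s t ⟧
  g≤E₀ s t with H s t | simple s t
  ... | true  | G+1≤1 = +≤+ (ℕ.+-cancelʳ-≤ 1 (G s t) 0 G+1≤1)
  ... | false | G+0≤1 = +≤+ (subst (ℕ._≤ 1) (ℕ.+-identityʳ (G s t)) G+0≤1)

  crossing : Subset n → Subset k → ℤ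
  crossing X T = ⟪ (λ s → ⟪ g s , T ⟫) , ∁ X ⟫

  crossing≥0 : ∀ X T → 0ℤ ≤ crossing X T
  crossing≥0 X T = ⟪⟫-≥0 (λ s → ⟪⟫-≥0 (g≥0 s) T) (∁ X)

  -- Only edges between `X` and `Y` are counted twice on the left, and they are edges of the
  -- complement of `H`. Crossing edges join S - X to `T`, which is disjoint from `Y`, so the degree
  -- sums over `X` and `Y` miss them.
  degree-bound : ∀ X Y T → T ⊆ ∁ Y →
    (⟪ (λ s → sum (g s)) , X ⟫ + ⟪ (λ t → sum (λ s → g s t)) , Y ⟫) + crossing X T ≤
    sum (λ s → sum (g s)) + ⟪ (λ s → ⟪ ⟦ bipComplement H ⟧ᴹ s , Y ⟫) , X ⟫
  degree-bound X Y T T⊆∁Y = ≤-trans (≤-reflexive lhs) (≤-trans (sum-mono pt) (≤-reflexive (∑-distrib-+ (λ s → sum (g s)) _)))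
    where
    lhs : (⟪ (λ s → sum (g s)) , X ⟫ + ⟪ (λ t → sum (λ s → g s t)) , Y ⟫) + crossing X T ≡
          sum (λ s → ((if lookup X s then sum (g s) else 0ℤ) + ⟪ g s , Y ⟫) + (if lookup (∁ X) s then ⟪ g s , T ⟫ else 0ℤ))
    lhs = sym (trans (∑-distrib-+ (λ s → (if lookup X s then sum (g s) else 0ℤ) + ⟪ g s , Y ⟫) _)
            (cong (_+ crossing X T) (trans (∑-distrib-+ (λ s → if lookup X s then sum (g s) else 0ℤ) _)
              (cong (λ z → ⟪ (λ s → sum (g s)) , X ⟫ + z) (sym (⟪sum⟫ g Y))))))
    eq₁ : ∀ r e y → (r + e) - ((r + y) + 0ℤ) ≡ e - y
    eq₁ = solve-∀
    eq₂ : ∀ y z t → ((y + z) + 0ℤ) - ((0ℤ + y) + t) ≡ z - t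
    eq₂ = solve-∀
    pt : ∀ s → ((if lookup X s then sum (g s) else 0ℤ) + ⟪ g s , Y ⟫) + (if lookup (∁ X) s then ⟪ g s , T ⟫ else 0ℤ) ≤
               sum (g s) + (if lookup X s then ⟪ ⟦ bipComplement H ⟧ᴹ s , Y ⟫ else 0ℤ)
    pt s rewrite lookup-map s not X with lookup X s
    ... | true  = ≤-from-gap (gap (⟪⟫-mono (g≤E₀ s) Y)) (eq₁ (sum (g s)) ⟪ ⟦ bipComplement H ⟧ᴹ s , Y ⟫ ⟪ g s , Y ⟫)
    ... | false rewrite sym (⟪⟫-∁ (g s) Y) = ≤-from-gap (gap (⟪⟫-monotone (g≥0 s) T⊆∁Y)) (eq₂ ⟪ g s , Y ⟫ ⟪ g s , ∁ Y ⟫ ⟪ g s , T ⟫)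

  -- A neighbour of `T` outside X ∪ Γ(T) is reached only by edges of `G`, and these cross.
  cover-bound : ∀ X T → p T ≤ R M (X ∪ Γ H T) + crossing X T
  cover-bound X T = ≤-trans (covers T) (rank-growth M (Γ (support (G +ᴳ H)) T) (X ∪ Γ H T) c c≥0 grow)
    where
    c : Fin n → ℤ
    c s = if lookup (∁ X) s then ⟪ g s , T ⟫ else 0ℤ
    c≥0 : ∀ s → 0ℤ ≤ c s
    c≥0 s with lookup (∁ X) s
    ... | true  = ⟪⟫-≥0 (g≥0 s) T
    ... | false = ≤-refl
    grow : ∀ s → lookup (Γ (support (G +ᴳ H)) T) s ≡ true → lookup (X ∪ Γ H T) s ≡ true ⊎ 1ℤ ≤ c s
    grow s e with Γ-elim (support (G +ᴳ H)) T s e | lookup-zipWith _∨_ s X (Γ H T) | lookup-map s not X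
    ... | t , t∈T , st | e₁ | e₂ with lookup X s
    ...   | true  = inj₁ e₁
    ...   | false rewrite e₂ with H s t in h
    ...     | true  = inj₁ (trans e₁ (Γ-intro H T s t t∈T h))
    ...     | false = inj₂ (≤-trans (+≤+ (positive (G s t) st)) (⟪⟫-member (g≥0 s) {T} t∈T))
      where
      positive : ∀ m → not (m ℕ.+ 0 ≡ᵇ 0) ≡ true → 1 ℕ.≤ m
      positive (suc m) _ = ℕ.s≤s ℕ.z≤n

theorem5 : (n k : ℕ) → 0 < n → 0 < k →
    (H₀ : SimpleBigraph n k) → (M : Matroid n) →
    (p : Subset k → ℤ) → FullySupermodular p →
    (mS : Fin n → ℕ) → (mT : Fin k → ℕ) → (γ : ℕ) →
    m̃ mS ⊤ ≡ γ → m̃ mT ⊤ ≡ γ →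
    (Σ (Bigraph n k) (λ G → Fits G mS mT × IsSimple (G +ᴳ H₀) × Covers M (G +ᴳ H₀) p))
    ⇔
    (((X : Subset n) → (Y : Subset k) →
    (+ m̃ mS X) ℤ.+ (+ m̃ mT Y) - (+ dS (bipComplement H₀) X Y) ≤ + γ)
    ×
    ((X : Subset n) → (Y : Subset k) → (T₀ : Subset k) → T₀ ⊆ ∁ Y →
    (+ m̃ mS X) ℤ.+ (+ m̃ mT Y) - (+ dS (bipComplement H₀) X Y) ℤ.+ p T₀
    - (+ Matroid.rank M (X ∪ Γ H₀ T₀)) ≤ + γ))
theorem5 n k _ _ H M p p-super mS mT γ ΣmS ΣmT = mk⇔ necessary sufficient
  where
  open Sufficiency H M p p-super mS mT

  ΣμS : sum μS ≡ + γ
  ΣμS = trans (sym (⟪⟫-⊤ μS)) (trans (sym (+-m̃ mS ⊤)) (cong +_ ΣmS))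
  ΣμT : sum μT ≡ + γ
  ΣμT = trans (sym (⟪⟫-⊤ μT)) (trans (sym (+-m̃ mT ⊤)) (cong +_ ΣmT))

  d : Subset n → Subset k → ℤ
  d X Y = ⟪ (λ s → ⟪ ⟦ E₀ ⟧ᴹ s , Y ⟫) , X ⟫

  lhs : ∀ X Y → (+ m̃ mS X) + (+ m̃ mT Y) - (+ dS E₀ X Y) ≡ ⟪ μS , X ⟫ + ⟪ μT , Y ⟫ - d X Y
  lhs X Y = cong₂ _-_ (cong₂ _+_ (+-m̃ mS X) (+-m̃ mT Y)) (+-dS E₀ X Y)

  Cond₁ Cond₂ : Set
  Cond₁ = ∀ X Y → (+ m̃ mS X) + (+ m̃ mT Y) - (+ dS E₀ X Y) ≤ + γ
  Cond₂ = ∀ X Y T → T ⊆ ∁ Y → (+ m̃ mS X) + (+ m̃ mT Y) - (+ dS E₀ X Y) + p T - R M (X ∪ Γ H T) ≤ + γ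

  Solution : Set
  Solution = Σ (Bigraph n k) (λ G → Fits G mS mT × IsSimple (G +ᴳ H) × Covers M (G +ᴳ H) p)

  necessary : Solution → Cond₁ × Cond₂
  necessary (G , (degS≡ , degT≡) , simple , covers) = cond₁ , cond₂
    where
    open Necessity H M p G simple covers
    rows : ∀ s → sum (g s) ≡ μS s
    rows s = trans (sym (+-sumFin k (G s))) (cong +_ (degS≡ s))
    cols : ∀ t → sum (λ s → g s t) ≡ μT t
    cols t = trans (sym (+-sumFin n (λ s → G s t))) (cong +_ (degT≡ t))
    bound : ∀ X Y T → T ⊆ ∁ Y → (⟪ μS , X ⟫ + ⟪ μT , Y ⟫) + crossing X T ≤ + γ + d X Y
    bound X Y T T⊆ = ≤-trans (≤-reflexive (cong (_+ crossing X T) (cong₂ _+_ (⟪⟫-cong (λ s → sym (rows s)) X) (⟪⟫-cong (λ t → sym (cols t)) Y))))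
      (≤-trans (degree-bound X Y T T⊆) (≤-reflexive (cong (_+ d X Y) (trans (sum-cong-≗ rows) ΣμS))))
    cond₁ : Cond₁
    cond₁ X Y = ≤-trans (≤-reflexive (lhs X Y))
      (≤-from-gap (gap (bound X Y ⊥ ⊥⊆) ⊹ crossing≥0 X ⊥) (eq (⟪ μS , X ⟫ + ⟪ μT , Y ⟫) (d X Y) (crossing X ⊥) (+ γ)))
      where
      eq : ∀ a d c γ → γ - (a - d) ≡ ((γ + d) - (a + c)) + c
      eq = solve-∀
    cond₂ : Cond₂
    cond₂ X Y T T⊆ = ≤-trans (≤-reflexive (cong (λ z → z + p T - R M (X ∪ Γ H T)) (lhs X Y)))
      (≤-from-gap (gap (bound X Y T T⊆) ⊹ gap (cover-bound X T))
        (eq (⟪ μS , X ⟫ + ⟪ μT , Y ⟫) (d X Y) (crossing X T) (+ γ) (p T) (R M (X ∪ Γ H T))))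
      where
      eq : ∀ a d c γ p r → γ - (a - d + p - r) ≡ ((γ + d) - (a + c)) + ((r + c) - p)
      eq = solve-∀

  sufficient : Cond₁ × Cond₂ → Solution
  sufficient (cond₁ , cond₂) = realise (sufficiency (trans ΣμS (sym ΣμT)) C≥0 p≤)
    where
    ΣμT≡ : ∀ Z → + γ ≡ ⟪ μT , Z ⟫ + ⟪ μT , ∁ Z ⟫
    ΣμT≡ Z = trans (sym ΣμT) (sym (⟪⟫-∁ μT Z))
    C≥0 : ∀ X Z → 0ℤ ≤ C X Z
    C≥0 X Z = ≤-from-gap (gap (≤-trans (≤-reflexive (sym (lhs X (∁ Z)))) (cond₁ X (∁ Z))))
      (trans (eq ⟪ μT , Z ⟫ ⟪ μT , ∁ Z ⟫ ⟪ μS , X ⟫ (d X (∁ Z))) (cong (λ z → z - (⟪ μS , X ⟫ + ⟪ μT , ∁ Z ⟫ - d X (∁ Z))) (sym (ΣμT≡ Z))))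
      where
      eq : ∀ z y x c → (z + (- x + c)) - 0ℤ ≡ (z + y) - (x + y - c)
      eq = solve-∀
    p≤ : ∀ X Z T → T ⊆ Z → p T ≤ C X Z + R M (X ∪ Γ H T)
    p≤ X Z T T⊆Z = ≤-from-gap
      (gap (≤-trans (≤-reflexive (cong (λ z → z + p T - R M (X ∪ Γ H T)) (sym (lhs X (∁ Z)))))
                    (cond₂ X (∁ Z) T (λ x∈T → x∉p⇒x∈∁p (x∈p⇒x∉∁p (T⊆Z x∈T))))))
      (trans (eq ⟪ μT , Z ⟫ ⟪ μT , ∁ Z ⟫ ⟪ μS , X ⟫ (d X (∁ Z)) (p T) (R M (X ∪ Γ H T)))
             (cong (λ z → z - (⟪ μS , X ⟫ + ⟪ μT , ∁ Z ⟫ - d X (∁ Z) + p T - R M (X ∪ Γ H T))) (sym (ΣμT≡ Z))))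
      where
      eq : ∀ z y x c p r → (z + (- x + c) + r) - p ≡ (z + y) - (x + y - c + p - r)
      eq = solve-∀

    realise : Augmentation (λ F → (∀ T → p T ≤ ⟪ col F , T ⟫) × (∀ A → ⟪ row F , A ⟫ ≤ R M A)) → Solution
    realise (E , F , E⊑E₀ , rE , cE , F⊆ , p≤F , F≤R) = G , (degS≡ , degT≡) , simple , covers
      where
      G : Bigraph n k
      G = indicator E
      degS≡ : ∀ s → degS G s ≡ mS s
      degS≡ s = +-injective (trans (+-sumFin k (G s)) (trans (sum-cong-≗ (λ t → +-indicator (E s t))) (rE s)))
      degT≡ : ∀ t → degT G t ≡ mT t
      degT≡ t = +-injective (trans (+-sumFin n (λ s → G s t)) (trans (sum-cong-≗ (λ s → +-indicator (E s t))) (cE t)))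
      simple : IsSimple (G +ᴳ H)
      simple s t with E s t in e | H s t in h
      ... | false | false = ℕ.z≤n
      ... | false | true  = ℕ.s≤s ℕ.z≤n
      ... | true  | false = ℕ.s≤s ℕ.z≤n
      ... | true  | true  = contradiction (trans (sym (E⊑E₀ s t e)) (cong not h)) λ ()
      F⊑support : F ⊑ support (G +ᴳ H)
      F⊑support s t f with E s t in e | H s t in h
      ... | true  | _     = refl
      ... | false | true  = refl
      ... | false | false = contradiction (trans (sym e) (F⊆ s t f (cong not h))) λ ()
      covers : Covers M (G +ᴳ H) p
      covers Y = ≤-trans (p≤F Y) (≤-trans (⟪col⟫≤⟪row⟫ F (support (G +ᴳ H)) F⊑support Y) (F≤R (Γ (support (G +ᴳ H)) Y)))
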